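{- A theta graph $\theta_{j,k,\ell}$ is an $i$-graph if and only if it is not one of the following seven graphs: $\theta_{1,2,2}$, $\theta_{2,2,2}$, $\theta_{2,2,3}$, $\theta_{2,2,4}$, $\theta_{2,3,3}$, $\theta_{2,3,4}$, $\theta_{3,3,3}$.
   Context: All graphs are finite and simple. For a graph $G$, $i(G)$ is the minimum cardinality of an independent dominating set of $G$; such a minimum set is an $i$-set. The $i$-graph $\mathcal{I}(G)$ of $G$ has the $i$-sets of $G$ as vertices, and two $i$-sets $X,Y$ are adjacent if and only if there are $u\in X$, $v\notin X$ with $uv\in E(G)$ and $Y=(X\setminus\{u\})\cup\{v\}$ (a token on $u$ slides along an edge to $v$). A graph $H$ is an $i$-graph (is $i$-graph realizable) if $H\cong\mathcal{I}(G)$ for some graph $G$. For integers $1\le j\le k\le \ell$ with $k\ge 2$, the theta graph $\theta_{j,k,\ell}$ consists of two vertices joined by three internally vertex-disjoint paths of lengths $j$, $k$ and $\ell$. -}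

module Defs where

open import Data.Nat using (ℕ; zero; suc; _+_; _∸_; _≤_; _≡ᵇ_)

open import Data.Bool using (Bool; true; false; _∧_; _∨_)
open import Data.Fin using (Fin; toℕ)
open import Data.Fin.Subset using (Subset; _∈_; _∉_; ∣_∣; inside; outside)
open import Data.Vec using (_[_]≔_)
open import Data.List using (List; []; _∷_; _++_)
open import Data.Bool.ListAction using (any)
open import Data.Product using (Σ; ∃; ∃-syntax; _×_; _,_)
open import Data.Sum using (_⊎_)
open import Function.Bundles using (_⇔_)
open import Relation.Binary.PropositionalEquality using (_≡_)

record Graph : Set where
  field
    n      : ℕ
    adj    : Fin n → Fin n → Bool
    sym    : ∀ x y → adj x y ≡ adj y x
    irrefl : ∀ x → adj x x ≡ false
open Graph public

module _ (G : Graph) where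
  Independent : Subset (n G) → Set
  Independent S = ∀ x y → x ∈ S → y ∈ S → adj G x y ≡ false

  Dominating : Subset (n G) → Set
  Dominating S = ∀ x → x ∈ S ⊎ (∃[ y ] (y ∈ S × adj G x y ≡ true))

  IndepDom : Subset (n G) → Set
  IndepDom S = Independent S × Dominating S

  ISet : Subset (n G) → Set
  ISet S = IndepDom S × (∀ T → IndepDom T → ∣ S ∣ ≤ ∣ T ∣)

  ISetAdj : Subset (n G) → Subset (n G) → Set
  ISetAdj X Y = ∃[ u ] ∃[ v ] (u ∈ X × v ∉ X × adj G u v ≡ true ×
                               Y ≡ (X [ u ]≔ outside) [ v ]≔ inside)

IGraphIso : (G : Graph) (m : ℕ) (A : Fin m → Fin m → Bool)
            (φ : Fin m → Subset (n G)) → Set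
IGraphIso G m A φ =
  (∀ x → ISet G (φ x)) ×
  (∀ x y → φ x ≡ φ y → x ≡ y) ×
  (∀ S → ISet G S → ∃[ x ] φ x ≡ S) ×
  (∀ x y → (A x y ≡ true) ⇔ ISetAdj G (φ x) (φ y))

IsIGraph : (m : ℕ) → (Fin m → Fin m → Bool) → Set
IsIGraph m A = Σ Graph λ G → Σ (Fin m → Subset (n G)) λ φ → IGraphIso G m A φ

-- Edges of a path of length L from a to b whose internal vertices are
-- s, s+1, ..., s+L-2.
pathEdges : ℕ → ℕ → ℕ → ℕ → List (ℕ × ℕ)
pathEdges a b s zero = []
pathEdges a b s (suc zero) = (a , b) ∷ []
pathEdges a b s (suc (suc L)) = (a , s) ∷ pathEdges s b (suc s) (suc L)

-- θ_{j,k,ℓ}: end vertices 0 and 1; internal vertices of the three paths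
-- numbered 2..j, j+1..j+k-1, j+k..j+k+ℓ-2.
thetaN : ℕ → ℕ → ℕ → ℕ
thetaN j k ℓ = (j + k + ℓ) ∸ 1

thetaEdges : ℕ → ℕ → ℕ → List (ℕ × ℕ)
thetaEdges j k ℓ = pathEdges 0 1 2 j ++ pathEdges 0 1 (suc j) k ++ pathEdges 0 1 (j + k) ℓ

thetaAdj : (j k ℓ : ℕ) → Fin (thetaN j k ℓ) → Fin (thetaN j k ℓ) → Bool
thetaAdj j k ℓ x y = any edge (thetaEdges j k ℓ)
  where
  edge : ℕ × ℕ → Bool
  edge (u , v) = ((u ≡ᵇ toℕ x) ∧ (v ≡ᵇ toℕ y)) ∨ ((u ≡ᵇ toℕ y) ∧ (v ≡ᵇ toℕ x))

exceptions : List (ℕ × ℕ × ℕ)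
exceptions = (1 , 2 , 2) ∷ (2 , 2 , 2) ∷ (2 , 2 , 3) ∷ (2 , 2 , 4) ∷
             (2 , 3 , 3) ∷ (2 , 3 , 4) ∷ (3 , 3 , 3) ∷ []

{-# OPTIONS --safe #-}
module Submission where

-- A graph H is an i-graph as soon as its vertices can be given equally large
-- token sets φ x such that adjacent vertices differ by one exchange, non-adjacent
-- ones by at least two, and each φ x is a maximal clique of the graph joining
-- tokens that share a set: take the complement of that graph and add vertices
-- that enlarge every other independent dominating set.  Such a family for a theta
-- graph can often be passed on to the theta graph with one edge subdivided, so
-- that five small families yield all positive cases.
--
-- Conversely, list for each token of an i-graph realisation the vertices holding
-- it.  Every directed edge of H leaves exactly one of these vertex sets, so all
-- candidates arise from an exact-cover search; for the seven exceptions each of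
-- them has a non-maximal set or two non-adjacent vertices one slide apart.

open import Defs
open import Data.Bool using (Bool; true; false; _∧_; _∨_; _xor_; not; if_then_else_; T; T?)
open import Data.Bool.ListAction using (any; all)
open import Data.Bool.Properties using (¬-not; ∧-identityʳ; ∧-zeroʳ; ∨-comm; ∨-assoc) renaming (_≟_ to _≟ᵇ_)
open import Data.Empty using (⊥; ⊥-elim)
open import Data.Fin using (Fin; zero; suc; toℕ; fromℕ<; splitAt; join; combine; remQuot; finToFun; funToFin)
open import Data.Fin.Properties using (any?; all?; suc-injective; toℕ-fromℕ<; toℕ-injective; toℕ<n; splitAt-↑ˡ; splitAt-↑ʳ; ↑ˡ-injective; ↑ʳ-injective; join-splitAt; remQuot-combine; finToFun-funToFin; combine-injectiveʳ) renaming (_≟_ to _≟ᶠ_)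
open import Data.Fin.Subset using (Subset; ∣_∣; inside; outside; _-_) renaming (_∈_ to _∈ˢ_; _∉_ to _∉ˢ_)
open import Data.Fin.Subset.Properties using (∣p∣≤n; x∈p∧x≢y⇒x∈p-y; x∈p⇒∣p-x∣<∣p∣)
open import Data.List using (List; []; _∷_; _++_; map; filterᵇ; allFin; cartesianProduct)
open import Data.List.Membership.Propositional using (_∈_)
open import Data.List.Membership.Propositional.Properties using (∈-map⁺; ∈-map⁻; ∈-++⁺ˡ; ∈-++⁺ʳ)
open import Data.List.Relation.Unary.Any using (here; there)
open import Data.Maybe using (Maybe; just; nothing)
open import Data.Nat using (ℕ; zero; suc; _+_; _*_; _^_; _≤_; _<_; _≤′_; ≤′-refl; ≤′-step; _≡ᵇ_; z≤n; s≤s)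
open import Data.Nat.Properties using (≤-trans; ≤-reflexive; ≤-refl; <-irrefl; ≤⇒≤′; ≤-<-connex; _<?_; ≮⇒≥; n≤1+n; m≤n⇒m≤1+n; m≤m+n; m≤n+m; +-suc; +-identityʳ; +-monoʳ-<) renaming (_≟_ to _≟ⁿ_)
open import Data.Product using (∃; ∃-syntax; _×_; _,_; proj₁; proj₂)
open import Data.Product.Properties using (≡-dec)
open import Data.List.Membership.DecPropositional (≡-dec _≟ⁿ_ (≡-dec _≟ⁿ_ _≟ⁿ_)) using (_∈?_)
open import Data.Sum using (_⊎_; inj₁; inj₂)
open import Data.Unit using (⊤; tt)
open import Data.Vec using (Vec; []; _∷_; tabulate; lookup; replicate; _[_]≔_) renaming (_++_ to _++ᵛ_)
open import Data.Vec.Properties using (tabulate-cong; tabulate∘lookup; lookup∘tabulate; lookup-splitAt; lookup-replicate; []=⇒lookup; lookup⇒[]=; lookup∘update; lookup∘update′)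
open import Function using (_∘_; id)
open import Function.Bundles using (_⇔_; mk⇔; module Equivalence)
open import Relation.Binary.Definitions using (DecidableEquality)
open import Relation.Binary.PropositionalEquality using (_≡_; _≢_; refl; trans; cong; cong₂; subst) renaming (sym to ≡-sym)
open import Relation.Nullary using (¬_; Dec; yes; no; does; ¬?)
open import Relation.Nullary.Decidable using (map′; dec-true; dec-false; _×-dec_; _⊎-dec_; _→-dec_; does-⇔; True; toWitness)

-- Subdividing the first edge of a path needs a marked first internal vertex. The vertex created is
-- marked again and the other paths keep their marks, so a marked path can grow to any length. Two
-- kinds of path never carry a mark: a single edge, and a path of length 2 beside the edge `s t`,
-- because in a triangle x y z the arriving token would share a set with every token of x, against
-- maximality of x. This is where the five families come from. Undoing one lengthening of (1,2,3),
-- (2,2,5), (2,4,4) or (3,3,4) gives an exception, a multigraph, or a path of length 1; for (1,3,3)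
-- it gives (1,2,3), whose path of length 2 lies in a triangle. Every other non-exceptional theta
-- graph is reached from one of the five. For the converse, the graph may have any number of tokens,
-- but on a connected H a token that ever moves is determined by the set of vertices holding it,
-- being the only token to leave some directed edge. So the search ranges over subsets of at most
-- eight vertices.

true≢false : ∀ {b} → b ≡ true → b ≡ false → ⊥
true≢false refl ()

separated : ∀ {X : Set} (f : X → Bool) {u v} → f u ≡ true → f v ≡ false → v ≢ u
separated f fu fv refl = true≢false fu fv

∧-true : ∀ {a b} → a ∧ b ≡ true → a ≡ true × b ≡ true
∧-true {true} {true} refl = refl , refl

-- Token sets and exchanges

size : ∀ {N} → (Fin N → Bool) → ℕ
size f = ∣ tabulate f ∣

size-cong : ∀ {N} {f g : Fin N → Bool} → (∀ u → f u ≡ g u) → size f ≡ size g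
size-cong eq = cong ∣_∣ (tabulate-cong eq)

size-without : ∀ {N} {f g : Fin N → Bool} a → f a ≡ true → g a ≡ false →
               (∀ u → u ≢ a → f u ≡ g u) → size f ≡ suc (size g)
size-without zero fa ga eq rewrite fa | ga = cong suc (size-cong λ u → eq (suc u) λ ())
size-without {f = f} {g} (suc a) fa ga eq
  with f zero | g zero | eq zero (λ ()) | size-without a fa ga (λ u u≢a → eq (suc u) λ { refl → u≢a refl })
... | true  | .true  | refl | ih = cong suc ih
... | false | .false | refl | ih = ih

record Slide {N} (f g : Fin N → Bool) : Set where
  constructor slide
  field
    from to : Fin N
    from∈ : f from ≡ true
    from∉ : g from ≡ false
    to∉   : f to ≡ false
    to∈   : g to ≡ true
    rest  : ∀ u → u ≢ from → u ≢ to → f u ≡ g u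

slide-sym : ∀ {N} {f g : Fin N → Bool} → Slide f g → Slide g f
slide-sym (slide a d p q r s e) = slide d a s r q p (λ u u≢d u≢a → ≡-sym (e u u≢a u≢d))

slide-size : ∀ {N} {f g : Fin N → Bool} → Slide f g → size f ≡ size g
slide-size {N} {f} {g} (slide a d fa ga fd gd rest) =
  trans (size-without a fa ha f~h) (≡-sym (size-without d gd hd g~h))
  where
  h : Fin N → Bool
  h u = f u ∧ not (does (u ≟ᶠ a))
  ha : h a ≡ false
  ha rewrite fa | dec-true (a ≟ᶠ a) refl = refl
  hd : h d ≡ false
  hd rewrite fd = refl
  f~h : ∀ u → u ≢ a → f u ≡ h u
  f~h u u≢a rewrite dec-false (u ≟ᶠ a) u≢a = ≡-sym (∧-identityʳ (f u))
  g~h : ∀ u → u ≢ d → g u ≡ h u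
  g~h u u≢d with u ≟ᶠ a
  ... | yes refl rewrite ga | fa = refl
  ... | no u≢a = trans (≡-sym (rest u u≢a u≢d)) (≡-sym (∧-identityʳ (f u)))

-- One-sided, because the sets compared have equal size: two tokens missing one way already exclude
-- a single exchange.
TwoMissing : ∀ {N} → (f g : Fin N → Bool) → Set
TwoMissing f g = ∃[ a ] ∃[ b ] a ≢ b × (f a ≡ true × g a ≡ false) × (f b ≡ true × g b ≡ false)

-- Realisations and marked paths

record Realisation (W : Set) (A : W → W → Bool) : Set where
  field
    N         : ℕ
    φ         : W → Fin N → Bool
    nonempty  : ∀ x → ∃[ u ] φ x u ≡ true
    same-size : ∀ x y → size (φ x) ≡ size (φ y)
    adjacent  : ∀ x y → A x y ≡ true → Slide (φ x) (φ y)
    distant   : ∀ x y → A x y ≡ false → x ≢ y → TwoMissing (φ x) (φ y)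
    maximal   : ∀ x v → φ x v ≡ false →
                ∃[ u ] φ x u ≡ true × (∀ w → φ w u ≡ true → φ w v ≡ false)

-- For a path x y z: y is the only vertex holding both the token b that leaves
-- on the step to z and the token d that arrived on the step from x.
Marked : ∀ {W A} → Realisation W A → W → W → W → Set
Marked R x y z = ∃[ b ] ∃[ d ]
  (φ x b ≡ true × φ y b ≡ true × φ z b ≡ false) ×
  (φ x d ≡ false × φ y d ≡ true × φ z d ≡ true) ×
  (∀ w → φ w b ≡ true → φ w d ≡ true → w ≡ y)
  where open Realisation R

-- An injection suffices: with fewer sets fewer pairs of tokens meet, so the witnesses of maximality
-- survive.
restrict : ∀ {W W′ A A′} → Realisation W A → (g : W′ → W) → (∀ {u v} → g u ≡ g v → u ≡ v) →
           (∀ u v → A (g u) (g v) ≡ A′ u v) → Realisation W′ A′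
restrict R g g-inj g-adj = record
  { N = N
  ; φ = φ ∘ g
  ; nonempty = nonempty ∘ g
  ; same-size = λ x y → same-size (g x) (g y)
  ; adjacent = λ x y xy → adjacent (g x) (g y) (trans (g-adj x y) xy)
  ; distant = λ x y xy x≢y → distant (g x) (g y) (trans (g-adj x y) xy) (x≢y ∘ g-inj)
  ; maximal = λ x v v∉ → let u , u∈ , apart = maximal (g x) v v∉ in u , u∈ , apart ∘ g
  }
  where open Realisation R

restrict-marked : ∀ {W W′ A A′} (R : Realisation W A) (g : W′ → W) (g-inj : ∀ {u v} → g u ≡ g v → u ≡ v)
                  (g-adj : ∀ u v → A (g u) (g v) ≡ A′ u v) → ∀ x y z →
                  Marked R (g x) (g y) (g z) → Marked (restrict {A′ = A′} R g g-inj g-adj) x y z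
restrict-marked R g g-inj g-adj x y z (b , d , bs , ds , only) =
  b , d , bs , ds , λ w wb wd → g-inj (only (g w) wb wd)

-- Subdividing an edge

module _ {W : Set} (_≟_ : DecidableEquality W) (A : W → W → Bool) (x y : W) where

  Subdivided : Maybe W → Maybe W → Bool
  Subdivided (just u) (just v) =
    if (does (u ≟ x) ∧ does (v ≟ y)) ∨ (does (u ≟ y) ∧ does (v ≟ x)) then false else A u v
  Subdivided (just u) nothing  = does (u ≟ x) ∨ does (u ≟ y)
  Subdivided nothing  (just v) = does (v ≟ x) ∨ does (v ≟ y)
  Subdivided nothing  nothing  = false

-- In the 2-section of the family, d is joined to b only through y.  With a new
-- token e, replacing y by the sets y − d + e and y − b + e, in this order from x
-- to z, therefore separates b from d and keeps all other cliques maximal.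
module Subdivide {W : Set} (_≟_ : DecidableEquality W) {A : W → W → Bool} (R : Realisation W A)
                 {x y z : W} (A-sym : ∀ u v → A u v ≡ A v u)
                 (xy : A x y ≡ true) (yz : A y z ≡ true)
                 (deg2 : ∀ w → w ≢ x → w ≢ z → A y w ≡ false)
                 (mark : Marked R x y z) where
  open Realisation R
  private
    b d : Fin N
    b = proj₁ mark
    d = proj₁ (proj₂ mark)
    xb : φ x b ≡ true
    xb = let _ , _ , (p , _ , _) , _ = mark in p
    yb : φ y b ≡ true
    yb = let _ , _ , (_ , p , _) , _ = mark in p
    zb : φ z b ≡ false
    zb = let _ , _ , (_ , _ , p) , _ = mark in p
    xd : φ x d ≡ false
    xd = let _ , _ , _ , (p , _ , _) , _ = mark in p
    yd : φ y d ≡ true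
    yd = let _ , _ , _ , (_ , p , _) , _ = mark in p
    zd : φ z d ≡ true
    zd = let _ , _ , _ , (_ , _ , p) , _ = mark in p
    only : ∀ w → φ w b ≡ true → φ w d ≡ true → w ≡ y
    only = let _ , _ , _ , _ , p = mark in p

    b≢d : b ≢ d
    b≢d refl = true≢false xb xd
    x≢y : x ≢ y
    x≢y refl = true≢false yd xd
    z≢y : z ≢ y
    z≢y refl = true≢false yb zb
    x≢z : x ≢ z
    x≢z refl = true≢false xb zb

  -- The decision is an argument, so that lemmas about `ψ (just w)` can match on it directly. Token
  -- `zero` is the new token e.
  old : (w : W) → Dec (w ≡ y) → Fin (suc N) → Bool
  old w (yes _) zero    = true
  old w (no _)  zero    = false
  old w (yes _) (suc u) = φ y u ∧ not (does (u ≟ᶠ b))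
  old w (no _)  (suc u) = φ w u

  ψ : Maybe W → Fin (suc N) → Bool
  ψ nothing  zero    = true
  ψ nothing  (suc u) = φ y u ∧ not (does (u ≟ᶠ d))
  ψ (just w) = old w (w ≟ y)

  private
    drop-≡ : ∀ {u c} → u ≡ c → φ y u ∧ not (does (u ≟ᶠ c)) ≡ false
    drop-≡ {u} refl rewrite dec-true (u ≟ᶠ u) refl = ∧-zeroʳ (φ y u)

    drop-≢ : ∀ {u c} → u ≢ c → φ y u ∧ not (does (u ≟ᶠ c)) ≡ φ y u
    drop-≢ {u} {c} u≢c rewrite dec-false (u ≟ᶠ c) u≢c = ∧-identityʳ (φ y u)

    drop-∉ : ∀ {u} c → φ y u ≡ false → φ y u ∧ not (does (u ≟ᶠ c)) ≡ false
    drop-∉ c yu rewrite yu = refl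

    ⊆y : ∀ c u → φ y u ∧ not (does (u ≟ᶠ c)) ≡ true → φ y u ≡ true
    ⊆y c u p = proj₁ (∧-true p)

    xy-slide = adjacent x y xy
    yz-slide = adjacent y z yz
    open Slide

    a : Fin N
    a = from xy-slide
    xa = from∈ xy-slide
    ya = from∉ xy-slide
    f : Fin N
    f = to yz-slide
    yf = to∉ yz-slide
    zf = to∈ yz-slide

    a≢d : a ≢ d
    a≢d refl = true≢false xa xd
    a≢b : a ≢ b
    a≢b refl = true≢false yb ya
    f≢d : f ≢ d
    f≢d refl = true≢false yd yf
    f≢b : f ≢ b
    f≢b refl = true≢false zf zb

    -- The token arriving at `y` has to be `d`, since any other slide would leave `d` unchanged
    -- between `x` and `y`.
    xy-rest : ∀ u → u ≢ a → u ≢ d → φ x u ≡ φ y u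
    xy-rest u u≢a u≢d with to xy-slide ≟ᶠ d
    ... | yes refl = rest xy-slide u u≢a u≢d
    ... | no ne with () ← true≢false yd (trans (≡-sym (rest xy-slide d (a≢d ∘ ≡-sym) (ne ∘ ≡-sym))) xd)

    yz-rest : ∀ u → u ≢ b → u ≢ f → φ y u ≡ φ z u
    yz-rest u u≢b u≢f with from yz-slide ≟ᶠ b
    ... | yes refl = rest yz-slide u u≢b u≢f
    ... | no ne with () ← true≢false yb (trans (rest yz-slide b (ne ∘ ≡-sym) (f≢b ∘ ≡-sym)) zb)

  private
    slide-x-new : ∀ dx → Slide (old x dx) (ψ nothing)
    slide-x-new (yes refl) = ⊥-elim (x≢y refl)
    slide-x-new (no _) = slide (suc a) zero xa (drop-∉ d ya) refl refl λ
      { zero _ ne → ⊥-elim (ne refl)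
      ; (suc u) u≢a _ → eq u (u≢a ∘ cong suc) }
      where
      eq : ∀ u → u ≢ a → φ x u ≡ φ y u ∧ not (does (u ≟ᶠ d))
      eq u u≢a with u ≟ᶠ d
      ... | yes refl rewrite xd | yd = refl
      ... | no u≢d = trans (xy-rest u u≢a u≢d) (≡-sym (∧-identityʳ (φ y u)))

    slide-new-y : ∀ dy → Slide (ψ nothing) (old y dy)
    slide-new-y (no y≢y) = ⊥-elim (y≢y refl)
    slide-new-y (yes _) = slide (suc b) (suc d)
      (trans (drop-≢ b≢d) yb) (drop-≡ refl) (drop-≡ refl) (trans (drop-≢ (b≢d ∘ ≡-sym)) yd) λ
      { zero _ _ → refl
      ; (suc u) u≢b u≢d → trans (drop-≢ (u≢d ∘ cong suc)) (≡-sym (drop-≢ (u≢b ∘ cong suc))) }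

    slide-y-z : ∀ dy dz → Slide (old y dy) (old z dz)
    slide-y-z (no y≢y) _ = ⊥-elim (y≢y refl)
    slide-y-z _ (yes z≡y) = ⊥-elim (z≢y z≡y)
    slide-y-z (yes _) (no _) = slide zero (suc f) refl refl (drop-∉ b yf) zf λ
      { zero ne _ → ⊥-elim (ne refl)
      ; (suc u) _ u≢f → eq u (u≢f ∘ cong suc) }
      where
      eq : ∀ u → u ≢ f → φ y u ∧ not (does (u ≟ᶠ b)) ≡ φ z u
      eq u u≢f with u ≟ᶠ b
      ... | yes refl rewrite zb | yb = refl
      ... | no u≢b = trans (∧-identityʳ (φ y u)) (yz-rest u u≢b u≢f)

    lift : ∀ {f g : Fin N → Bool} {f′ g′ : Fin (suc N) → Bool} → f′ zero ≡ g′ zero →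
           (∀ u → f u ≡ f′ (suc u)) → (∀ u → g u ≡ g′ (suc u)) → Slide f g → Slide f′ g′
    lift e0 ef eg (slide a d p q r s e) =
      slide (suc a) (suc d) (trans (≡-sym (ef a)) p) (trans (≡-sym (eg a)) q)
        (trans (≡-sym (ef d)) r) (trans (≡-sym (eg d)) s) λ
        { zero _ _ → e0
        ; (suc u) u≢a u≢d → trans (≡-sym (ef u))
            (trans (e u (u≢a ∘ cong suc) (u≢d ∘ cong suc)) (eg u)) }

    slide-old : ∀ u v du dv → A u v ≡ true → (u ≡ y → v ≢ x) → (v ≡ y → u ≢ x) →
                Slide (old u du) (old v dv)
    slide-old u v (yes refl) (yes refl) uv _ _ =
      let slide a d p q r s e = adjacent u u uv in ⊥-elim (true≢false p q)
    slide-old u v (no _) (no _) uv _ _ = lift refl (λ _ → refl) (λ _ → refl) (adjacent u v uv)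
    slide-old u v (yes refl) dv@(no _) uv v≢x _ with v ≟ z
    ... | yes refl = slide-y-z (yes refl) dv
    ... | no v≢z = ⊥-elim (true≢false uv (deg2 v (v≢x refl) v≢z))
    slide-old u v du@(no _) (yes refl) uv _ u≢x with u ≟ z
    ... | yes refl = slide-sym (slide-y-z (yes refl) du)
    ... | no u≢z = ⊥-elim (true≢false (trans (A-sym v u) uv) (deg2 u (u≢x refl) u≢z))

    -- Removing `c` from `φ y` costs at most one of the two tokens that `g` misses; the new token,
    -- missing from all other old sets, makes up for it.
    survivor : ∀ {g : Fin N → Bool} c → TwoMissing (φ y) g →
               ∃[ u ] (φ y u ∧ not (does (u ≟ᶠ c)) ≡ true × g u ≡ false)
    survivor c (a , b , a≢b , (ya , ga) , (yb , gb)) with a ≟ᶠ c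
    ... | yes refl = b , trans (drop-≢ (a≢b ∘ ≡-sym)) yb , gb
    ... | no a≢c = a , trans (drop-≢ a≢c) ya , ga

    missing-drop : ∀ {g : Fin N → Bool} c → TwoMissing g (φ y) → (h : Fin (suc N) → Bool) →
                   (∀ u → h (suc u) ≡ φ y u ∧ not (does (u ≟ᶠ c))) → (g′ : Fin (suc N) → Bool) →
                   (∀ u → g′ (suc u) ≡ g u) → TwoMissing g′ h
    missing-drop c (a , b , a≢b , (ga , ya) , (gb , yb)) h hs g′ gs =
      suc a , suc b , (a≢b ∘ suc-injective) ,
      (trans (gs a) ga , trans (hs a) (drop-∉ c ya)) ,
      (trans (gs b) gb , trans (hs b) (drop-∉ c yb))

    NonAdjacent : Maybe W → Maybe W → Set
    NonAdjacent (just u) (just v) = A u v ≡ false ⊎ (u ≡ x × v ≡ y) ⊎ (u ≡ y × v ≡ x)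
    NonAdjacent (just u) nothing  = u ≢ x × u ≢ y
    NonAdjacent nothing  (just v) = v ≢ x × v ≢ y
    NonAdjacent nothing  nothing  = ⊤

    missing-x-y : ∀ dx dy → TwoMissing (old x dx) (old y dy)
    missing-x-y (yes x≡y) _ = ⊥-elim (x≢y x≡y)
    missing-x-y _ (no y≢y) = ⊥-elim (y≢y refl)
    missing-x-y (no _) (yes _) = suc a , suc b , (a≢b ∘ suc-injective) ,
      (xa , drop-∉ b ya) , (xb , drop-≡ refl)

    missing-y-x : ∀ dx dy → TwoMissing (old y dy) (old x dx)
    missing-y-x (yes x≡y) _ = ⊥-elim (x≢y x≡y)
    missing-y-x _ (no y≢y) = ⊥-elim (y≢y refl)
    missing-y-x (no _) (yes _) = zero , suc d , (λ ()) ,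
      (refl , refl) , (trans (drop-≢ (b≢d ∘ ≡-sym)) yd , xd)

    missing-old : ∀ u v du dv → u ≢ v → A u v ≡ false → TwoMissing (old u du) (old v dv)
    missing-old u v (yes refl) (yes refl) u≢v uv = ⊥-elim (u≢v refl)
    missing-old u v (no _) (no _) u≢v uv =
      let a , b , a≢b , p , q = distant u v uv u≢v in
      suc a , suc b , (a≢b ∘ suc-injective) , p , q
    missing-old u v (yes refl) (no _) u≢v uv =
      let t , p , q = survivor b (distant u v uv u≢v) in
      zero , suc t , (λ ()) , (refl , refl) , p , q
    missing-old u v du@(no _) dv@(yes refl) u≢v uv =
      missing-drop b (distant u v uv u≢v) (old y dv) (λ _ → refl) (old u du) λ _ → refl

    missing-new : ∀ v dv → v ≢ x → v ≢ y → TwoMissing (ψ nothing) (old v dv)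
    missing-new v (yes v≡y) _ v≢y = ⊥-elim (v≢y v≡y)
    missing-new v (no _) v≢x v≢y with v ≟ z
    ... | yes refl = zero , suc b , (λ ()) , (refl , refl) , trans (drop-≢ b≢d) yb , zb
    ... | no v≢z =
      let t , p , q = survivor d (distant y v (deg2 v v≢x v≢z) (v≢y ∘ ≡-sym)) in
      zero , suc t , (λ ()) , (refl , refl) , p , q

    missing-from-new : ∀ v dv → v ≢ x → v ≢ y → TwoMissing (old v dv) (ψ nothing)
    missing-from-new v (yes v≡y) _ v≢y = ⊥-elim (v≢y v≡y)
    missing-from-new v dv@(no _) v≢x v≢y with v ≟ z
    ... | yes refl = suc d , suc f , (f≢d ∘ ≡-sym ∘ suc-injective) ,
                     (zd , drop-≡ refl) , (zf , drop-∉ d yf)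
    ... | no v≢z =
      missing-drop d (distant v y (trans (A-sym v y) (deg2 v v≢x v≢z)) v≢y)
        (ψ nothing) (λ _ → refl) (old v dv) λ _ → refl

    missing : ∀ u v → NonAdjacent u v → u ≢ v → TwoMissing (ψ u) (ψ v)
    missing nothing nothing _ ne = ⊥-elim (ne refl)
    missing nothing (just v) (v≢x , v≢y) _ = missing-new v (v ≟ y) v≢x v≢y
    missing (just v) nothing (v≢x , v≢y) _ = missing-from-new v (v ≟ y) v≢x v≢y
    missing (just u) (just v) (inj₁ uv) ne = missing-old u v (u ≟ y) (v ≟ y) (ne ∘ cong just) uv
    missing (just u) (just v) (inj₂ (inj₁ (refl , refl))) _ = missing-x-y (u ≟ y) (v ≟ y)
    missing (just u) (just v) (inj₂ (inj₂ (refl , refl))) _ = missing-y-x (v ≟ y) (u ≟ y)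

    non-adjacent : ∀ u v → Subdivided _≟_ A x y u v ≡ false → NonAdjacent u v
    non-adjacent nothing nothing _ = tt
    non-adjacent nothing (just v) e with v ≟ x | v ≟ y
    ... | no p | no q = p , q
    non-adjacent (just v) nothing e with v ≟ x | v ≟ y
    ... | no p | no q = p , q
    non-adjacent (just u) (just v) e with u ≟ x | v ≟ y | u ≟ y | v ≟ x
    ... | yes p | yes q | _ | _ = inj₂ (inj₁ (p , q))
    ... | yes p | no _ | yes q | yes r = inj₂ (inj₂ (q , r))
    ... | yes p | no _ | yes q | no _ = inj₁ e
    ... | yes p | no _ | no _ | _ = inj₁ e
    ... | no _ | _ | yes q | yes r = inj₂ (inj₂ (q , r))
    ... | no _ | _ | yes q | no _ = inj₁ e
    ... | no _ | _ | no _ | _ = inj₁ e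

    slides : ∀ u v → Subdivided _≟_ A x y u v ≡ true → Slide (ψ u) (ψ v)
    slides nothing nothing ()
    slides (just v) nothing e with v ≟ x | v ≟ y in eq
    ... | yes refl | dy = slide-x-new dy
    ... | no _ | yes refl = slide-sym (slide-new-y (yes refl))
    slides nothing (just v) e with v ≟ x | v ≟ y
    ... | yes refl | dy = slide-sym (slide-x-new dy)
    ... | no _ | yes refl = slide-new-y (yes refl)
    slides (just u) (just v) e = slide-old u v (u ≟ y) (v ≟ y) (proj₁ r) (proj₁ (proj₂ r)) (proj₂ (proj₂ r))
      where
      r : A u v ≡ true × (u ≡ y → v ≢ x) × (v ≡ y → u ≢ x)
      r with u ≟ x | v ≟ y | u ≟ y | v ≟ x
      ... | yes _ | no q | yes _ | no p = e , (λ _ → p) , (λ v≡y _ → q v≡y)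
      ... | yes _ | no q | no p | _ = e , (λ u≡y → ⊥-elim (p u≡y)) , (λ v≡y _ → q v≡y)
      ... | no q | _ | yes _ | no p = e , (λ _ → p) , λ _ → q
      ... | no q | _ | no p | _ = e , (λ u≡y → ⊥-elim (p u≡y)) , λ _ → q

    new⇒⊆y : ∀ w u → ψ w zero ≡ true → ψ w (suc u) ≡ true → φ y u ≡ true
    new⇒⊆y nothing u _ p = ⊆y d u p
    new⇒⊆y (just w) u p q with w ≟ y
    ... | yes _ = ⊆y b u q

    -- The old tokens in both replacements of `y` come from `φ y`, so no two old tokens meet that
    -- did not meet before.
    apart-old : ∀ {u v} → (∀ w → φ w u ≡ true → φ w v ≡ false) →
                ∀ w → ψ w (suc u) ≡ true → ψ w (suc v) ≡ false
    apart-old apart nothing p = drop-∉ d (apart y (⊆y d _ p))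
    apart-old apart (just w) p with w ≟ y
    ... | yes _ = drop-∉ b (apart y (⊆y b _ p))
    ... | no _ = apart w p

    apart-bd : ∀ w → ψ w (suc b) ≡ true → ψ w (suc d) ≡ false
    apart-bd nothing p = drop-≡ refl
    apart-bd (just w) p with w ≟ y
    ... | yes _ with () ← trans (≡-sym p) (drop-≡ refl)
    ... | no w≢y = ¬-not λ q → w≢y (only w p q)

    apart-sym : ∀ {u v} → (∀ w → ψ w u ≡ true → ψ w v ≡ false) → ∀ w → ψ w v ≡ true → ψ w u ≡ false
    apart-sym apart w p = ¬-not λ q → true≢false p (apart w q)

    outside-y : ∀ w → w ≢ y → ∃[ u ] φ w u ≡ true × φ y u ≡ false
    outside-y w w≢y with A w y in wy
    ... | true = let slide a d p q r s e = adjacent w y wy in a , p , q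
    ... | false = let a , b , _ , p , _ = distant w y wy w≢y in a , p

    apart-new : ∀ {u} → φ y u ≡ false → ∀ w → ψ w zero ≡ true → ψ w (suc u) ≡ false
    apart-new yu w p = ¬-not λ q → true≢false (new⇒⊆y w _ p q) yu

    Max : (Fin (suc N) → Bool) → Set
    Max g = ∀ v → g v ≡ false → ∃[ u ] g u ≡ true × (∀ w → ψ w u ≡ true → ψ w v ≡ false)

    -- In the set replacing `y`, `d` excludes `b` because the two no longer meet, and the new token
    -- excludes everything outside `φ y`. In any other set, the new token is excluded by a token
    -- outside `φ y`.
    maximal-old : ∀ w dw → Max (old w dw)
    maximal-old w (yes refl) (suc v) p with v ≟ᶠ b
    ... | yes refl = suc d , trans (drop-≢ (b≢d ∘ ≡-sym)) yd , apart-sym apart-bd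
    ... | no v≢b = zero , refl , apart-new (trans (≡-sym (∧-identityʳ (φ y v))) p)
    maximal-old w (no w≢y) zero p =
      let u , wu , yu = outside-y w w≢y in suc u , wu , apart-sym (apart-new yu)
    maximal-old w (no _) (suc v) p =
      let u , wu , apart = maximal w v p in suc u , wu , apart-old apart

    maximal-new : Max (ψ nothing)
    maximal-new (suc v) p with v ≟ᶠ d
    ... | yes refl = suc b , trans (drop-≢ b≢d) yb , apart-bd
    ... | no v≢d = zero , refl , apart-new (trans (≡-sym (∧-identityʳ (φ y v))) p)

    size-new : ∀ w → size (ψ w) ≡ size (ψ nothing)
    size-new nothing = refl
    size-new (just w) with w ≟ y
    ... | yes refl = ≡-sym (slide-size (slide-new-y (yes refl)))
    ... | no w≢y = trans (same-size w x) (slide-size (slide-x-new (no x≢y)))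

  subdivide : Realisation (Maybe W) (Subdivided _≟_ A x y)
  subdivide = record
    { N = suc N
    ; φ = ψ
    ; nonempty = nonempty-ψ
    ; same-size = λ u v → trans (size-new u) (≡-sym (size-new v))
    ; adjacent = slides
    ; distant = λ u v uv u≢v → missing u v (non-adjacent u v uv) u≢v
    ; maximal = λ { nothing → maximal-new ; (just w) → maximal-old w (w ≟ y) }
    }
    where
    nonempty-ψ : ∀ w → ∃[ u ] ψ w u ≡ true
    nonempty-ψ nothing = zero , refl
    nonempty-ψ (just w) with w ≟ y
    ... | yes _ = zero , refl
    ... | no _ = let u , p = nonempty w in suc u , p

  private
    ψ-old : ∀ {w} → w ≢ y → ∀ u → ψ (just w) (suc u) ≡ φ w u
    ψ-old {w} w≢y u with w ≟ y
    ... | yes w≡y = ⊥-elim (w≢y w≡y)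
    ... | no _ = refl

  -- The new token arrives at the new vertex and `b` leaves it on the next step. They meet nowhere
  -- else, because the set now standing for `y` has lost `b`; hence subdivision can be repeated.
  subdivide-marked : Marked subdivide (just x) nothing (just y)
  subdivide-marked = suc b , zero ,
    (trans (ψ-old x≢y b) xb , trans (drop-≢ b≢d) yb , yb′) , (x0 , refl , y0) , only′
    where
    yb′ : ψ (just y) (suc b) ≡ false
    yb′ with y ≟ y
    ... | yes _ = drop-≡ refl
    ... | no y≢y = ⊥-elim (y≢y refl)
    x0 : ψ (just x) zero ≡ false
    x0 with x ≟ y
    ... | yes x≡y = ⊥-elim (x≢y x≡y)
    ... | no _ = refl
    y0 : ψ (just y) zero ≡ true
    y0 with y ≟ y
    ... | yes _ = refl
    ... | no y≢y = ⊥-elim (y≢y refl)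
    only′ : ∀ w → ψ w (suc b) ≡ true → ψ w zero ≡ true → w ≡ nothing
    only′ nothing _ _ = refl
    only′ (just w) p q with w ≟ y
    ... | yes _ with () ← trans (≡-sym p) (drop-≡ refl)

  -- If a replacement of `y` held both tokens of the other mark, `y` itself would have held them,
  -- forcing `y₂` to be `y`.
  keep-marked : ∀ {x₂ y₂ z₂} → x₂ ≢ y → y₂ ≢ y → z₂ ≢ y →
                Marked R x₂ y₂ z₂ → Marked subdivide (just x₂) (just y₂) (just z₂)
  keep-marked {x₂} {y₂} {z₂} x≢ y≢ z≢ (b₂ , d₂ , (p , q , r) , (s , t , u) , only₂) =
    suc b₂ , suc d₂ ,
    (trans (ψ-old x≢ b₂) p , trans (ψ-old y≢ b₂) q , trans (ψ-old z≢ b₂) r) ,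
    (trans (ψ-old x≢ d₂) s , trans (ψ-old y≢ d₂) t , trans (ψ-old z≢ d₂) u) , only′
    where
    only′ : ∀ w → ψ w (suc b₂) ≡ true → ψ w (suc d₂) ≡ true → w ≡ just y₂
    only′ nothing p q = ⊥-elim (y≢ (≡-sym (only₂ y (⊆y d b₂ p) (⊆y d d₂ q))))
    only′ (just w) p q with w ≟ y
    ... | yes _ = ⊥-elim (y≢ (≡-sym (only₂ y (⊆y b b₂ p) (⊆y b d₂ q))))
    ... | no _ = cong just (only₂ w p q)

-- Building a graph from a realisation

does⇒ : ∀ {P : Set} (P? : Dec P) → does P? ≡ true → P
does⇒ (yes p) _ = p

lookup-extensional : ∀ {n} (X Y : Subset n) → (∀ i → lookup X i ≡ lookup Y i) → X ≡ Y
lookup-extensional X Y eq =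
  trans (≡-sym (tabulate∘lookup X)) (trans (tabulate-cong eq) (tabulate∘lookup Y))

∣++∣ : ∀ {m n} (X : Subset m) → ∣ X ++ᵛ replicate n outside ∣ ≡ ∣ X ∣
∣++∣ {n = zero} [] = refl
∣++∣ {n = suc n} [] = ∣++∣ {n = n} []
∣++∣ (true ∷ X) = cong suc (∣++∣ X)
∣++∣ (false ∷ X) = ∣++∣ X

injection-≤∣∣ : ∀ {n} m (X : Subset n) (f : Fin m → Fin n) → (∀ {i j} → f i ≡ f j → i ≡ j) →
                (∀ i → f i ∈ˢ X) → m ≤ ∣ X ∣
injection-≤∣∣ zero X f inj f∈ = z≤n
injection-≤∣∣ (suc m) X f inj f∈ = ≤-trans (s≤s ih) (x∈p⇒∣p-x∣<∣p∣ (f∈ zero))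
  where
  ih : m ≤ ∣ X - f zero ∣
  ih = injection-≤∣∣ m (X - f zero) (f ∘ suc) (suc-injective ∘ inj)
         (λ i → x∈p∧x≢y⇒x∈p-y (f∈ (suc i)) λ eq → case-absurd (inj eq))
    where
    case-absurd : ∀ {i : Fin m} → suc i ≢ zero
    case-absurd ()

module _ {n} (X : Subset n) {u v : Fin n} where
  moved : Subset n
  moved = (X [ u ]≔ outside) [ v ]≔ inside

  moved-to : lookup moved v ≡ inside
  moved-to = lookup∘update v (X [ u ]≔ outside) inside

  moved-from : u ≢ v → lookup moved u ≡ outside
  moved-from u≢v = trans (lookup∘update′ u≢v (X [ u ]≔ outside) inside) (lookup∘update u X outside)

  moved-rest : ∀ {w} → w ≢ u → w ≢ v → lookup moved w ≡ lookup X w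
  moved-rest w≢u w≢v = trans (lookup∘update′ w≢v (X [ u ]≔ outside) inside) (lookup∘update′ w≢u X outside)

-- Besides the tokens, G has for each set S of tokens the blockers z_S, in N + 1
-- copies, adjacent to the tokens outside S (and to all tokens if S contains some
-- φ x).  An independent dominating set without blockers is then some φ x, while
-- one with a blocker has more than N elements.
module ToIGraph {m : ℕ} {A : Fin m → Fin m → Bool} (R : Realisation (Fin m) A) (x₀ : Fin m) where
  open Realisation R

  copies blockers : ℕ
  copies   = suc N
  blockers = 2 ^ N * copies

  fromBool : Bool → Fin 2
  fromBool false = zero
  fromBool true  = suc zero

  toBool : Fin 2 → Bool
  toBool zero = false
  toBool (suc _) = true

  blocked : Fin blockers → Fin N → Bool
  blocked p u = toBool (finToFun (proj₁ (remQuot {2 ^ N} copies p)) u)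

  blocker : (Fin N → Bool) → Fin copies → Fin blockers
  blocker S i = combine (funToFin (fromBool ∘ S)) i

  toBool∘fromBool : ∀ b → toBool (fromBool b) ≡ b
  toBool∘fromBool true = refl
  toBool∘fromBool false = refl

  blocked-combine : ∀ s i u → blocked (combine s i) u ≡ toBool (finToFun s u)
  blocked-combine s i u =
    cong (λ (r : Fin (2 ^ N) × Fin copies) → toBool (finToFun (proj₁ r) u)) (remQuot-combine s i)

  blocked-blocker : ∀ S i u → blocked (blocker S i) u ≡ S u
  blocked-blocker S i u = trans (blocked-combine (funToFin (fromBool ∘ S)) i u)
    (trans (cong toBool (finToFun-funToFin (fromBool ∘ S) u)) (toBool∘fromBool (S u)))

  blocked-copy : ∀ p i u → blocked (combine (proj₁ (remQuot {2 ^ N} copies p)) i) u ≡ blocked p u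
  blocked-copy p i u = blocked-combine (proj₁ (remQuot {2 ^ N} copies p)) i u

  -- The first clause lets a `φ x` not contained in S dominate the blocker of S, the second one a
  -- `φ x` inside S; together they keep every `φ x` dominating.
  Attached : Fin N → (Fin N → Bool) → Set
  Attached u S = S u ≡ false ⊎ ∃[ x ] (∀ v → φ x v ≡ true → S v ≡ true)

  E : Fin N ⊎ Fin blockers → Fin N ⊎ Fin blockers → Set
  E (inj₁ u) (inj₁ v) = u ≢ v × (∀ x → ¬ (φ x u ≡ true × φ x v ≡ true))
  E (inj₁ u) (inj₂ p) = Attached u (blocked p)
  E (inj₂ p) (inj₁ u) = Attached u (blocked p)
  E (inj₂ p) (inj₂ q) = ⊥

  attached? : ∀ u S → Dec (Attached u S)
  attached? u S = (S u ≟ᵇ false) ⊎-dec any? λ x → all? λ v → (φ x v ≟ᵇ true) →-dec (S v ≟ᵇ true)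

  E? : ∀ i j → Dec (E i j)
  E? (inj₁ u) (inj₁ v) = ¬? (u ≟ᶠ v) ×-dec all? λ x → ¬? ((φ x u ≟ᵇ true) ×-dec (φ x v ≟ᵇ true))
  E? (inj₁ u) (inj₂ p) = attached? u (blocked p)
  E? (inj₂ p) (inj₁ u) = attached? u (blocked p)
  E? (inj₂ p) (inj₂ q) = no λ ()

  E-sym : ∀ i j → E i j → E j i
  E-sym (inj₁ u) (inj₁ v) (u≢v , h) = u≢v ∘ ≡-sym , λ x (p , q) → h x (q , p)
  E-sym (inj₁ u) (inj₂ p) e = e
  E-sym (inj₂ p) (inj₁ u) e = e

  E-irrefl : ∀ i → ¬ E i i
  E-irrefl (inj₁ u) (u≢u , _) = u≢u refl

  G : Graph
  G = record
    { n = N + blockers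
    ; adj = λ i j → does (E? (splitAt N i) (splitAt N j))
    ; sym = λ i j → does-⇔ (mk⇔ (E-sym (splitAt N i) (splitAt N j)) (E-sym (splitAt N j) (splitAt N i)))
                      (E? (splitAt N i) (splitAt N j)) (E? (splitAt N j) (splitAt N i))
    ; irrefl = λ i → dec-false (E? (splitAt N i) (splitAt N i)) (E-irrefl (splitAt N i))
    }

  vtx : Fin N ⊎ Fin blockers → Fin (N + blockers)
  vtx = join N blockers

  split-vtx : ∀ i → splitAt N (vtx i) ≡ i
  split-vtx (inj₁ u) = splitAt-↑ˡ N u blockers
  split-vtx (inj₂ p) = splitAt-↑ʳ N blockers p

  vtx-split : ∀ i → vtx (splitAt N i) ≡ i
  vtx-split = join-splitAt N blockers

  adj⇒E : ∀ i j → adj G i j ≡ true → E (splitAt N i) (splitAt N j)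
  adj⇒E i j = does⇒ (E? _ _)

  E⇒adj : ∀ i j → E i j → adj G (vtx i) (vtx j) ≡ true
  E⇒adj i j e = dec-true (E? _ _) (subst (λ i → E i _) (≡-sym (split-vtx i)) (subst (E i) (≡-sym (split-vtx j)) e))

  ¬E⇒¬adj : ∀ i j → ¬ E (splitAt N i) (splitAt N j) → adj G i j ≡ false
  ¬E⇒¬adj i j ¬e = dec-false (E? _ _) ¬e

  φ⁺ : Fin m → Fin N ⊎ Fin blockers → Bool
  φ⁺ x (inj₁ u) = φ x u
  φ⁺ x (inj₂ _) = false

  Φ : Fin m → Subset (N + blockers)
  Φ x = tabulate (φ x) ++ᵛ replicate blockers outside

  lookup-Φ : ∀ x i → lookup (Φ x) i ≡ φ⁺ x (splitAt N i)
  lookup-Φ x i rewrite lookup-splitAt N (tabulate (φ x)) (replicate blockers outside) i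
    with splitAt N i
  ... | inj₁ u = lookup∘tabulate (φ x) u
  ... | inj₂ p = lookup-replicate p outside

  ∈Φ⇒ : ∀ x {i} → i ∈ˢ Φ x → φ⁺ x (splitAt N i) ≡ true
  ∈Φ⇒ x {i} i∈ = trans (≡-sym (lookup-Φ x i)) ([]=⇒lookup i∈)

  ⇒∈Φ : ∀ x i → φ⁺ x i ≡ true → vtx i ∈ˢ Φ x
  ⇒∈Φ x i e = lookup⇒[]= (vtx i) (Φ x) (trans (lookup-Φ x (vtx i)) (trans (cong (φ⁺ x) (split-vtx i)) e))

  ∣Φ∣ : ∀ x → ∣ Φ x ∣ ≡ size (φ x)
  ∣Φ∣ x = ∣++∣ (tabulate (φ x))

  Φ-dominates : ∀ x i → φ⁺ x i ≡ true ⊎ ∃[ u ] (φ x u ≡ true × E i (inj₁ u))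
  Φ-dominates x (inj₁ v) with φ x v in eq
  ... | true = inj₁ refl
  ... | false = let u , u∈ , apart = maximal x v eq in
    inj₂ (u , u∈ , separated (φ x) u∈ eq , λ w (wv , wu) → true≢false wv (apart w wu))
  Φ-dominates x (inj₂ p) with any? (λ u → (φ x u ≟ᵇ true) ×-dec (blocked p u ≟ᵇ false))
  ... | yes (u , u∈ , u∉) = inj₂ (u , u∈ , inj₁ u∉)
  ... | no ¬u = let u , u∈ = nonempty x in
    inj₂ (u , u∈ , inj₂ (x , λ v v∈ → ¬-not λ v∉ → ¬u (v , v∈ , v∉)))

  Φ-indepDom : ∀ x → IndepDom G (Φ x)
  Φ-indepDom x = indep , dom
    where
    indep : Independent G (Φ x)
    indep i j i∈ j∈ = ¬E⇒¬adj i j (go (splitAt N i) (splitAt N j) (∈Φ⇒ x i∈) (∈Φ⇒ x j∈))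
      where
      go : ∀ i j → φ⁺ x i ≡ true → φ⁺ x j ≡ true → ¬ E i j
      go (inj₁ u) (inj₁ v) p q (_ , h) = h x (p , q)
    dom : Dominating G (Φ x)
    dom i with Φ-dominates x (splitAt N i)
    ... | inj₁ p = inj₁ (subst (_∈ˢ Φ x) (vtx-split i) (⇒∈Φ x (splitAt N i) p))
    ... | inj₂ (u , u∈ , e) = inj₂ (vtx (inj₁ u) , ⇒∈Φ x (inj₁ u) u∈ ,
      subst (λ i → adj G i _ ≡ true) (vtx-split i) (E⇒adj _ _ e))

  module _ (X : Subset (N + blockers)) (X-indepDom : IndepDom G X) where
    private
      indep : ∀ i j → vtx i ∈ˢ X → vtx j ∈ˢ X → ¬ E i j
      indep i j i∈ j∈ e = true≢false (E⇒adj i j e) (proj₁ X-indepDom (vtx i) (vtx j) i∈ j∈)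

      dom : ∀ i → vtx i ∈ˢ X ⊎ ∃[ j ] (vtx j ∈ˢ X × E i j)
      dom i with proj₂ X-indepDom (vtx i)
      ... | inj₁ i∈ = inj₁ i∈
      ... | inj₂ (j , j∈ , e) = inj₂ (splitAt N j , subst (_∈ˢ X) (≡-sym (vtx-split j)) j∈ ,
        subst (λ i → E i _) (split-vtx i) (adj⇒E (vtx i) j e))

    -- Copies of a blocker have the same neighbours, so X contains all of them or none.
    blocker∈⇒large : ∀ p → vtx (inj₂ p) ∈ˢ X → copies ≤ ∣ X ∣
    blocker∈⇒large p p∈ = injection-≤∣∣ copies X (vtx ∘ inj₂ ∘ copy)
        (λ eq → combine-injectiveʳ q _ q _ (↑ʳ-injective N _ _ eq)) copy∈
      where
      q : Fin (2 ^ N)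
      q = proj₁ (remQuot {2 ^ N} copies p)
      copy : Fin copies → Fin blockers
      copy = combine q
      copy∈ : ∀ i → vtx (inj₂ (copy i)) ∈ˢ X
      copy∈ i with dom (inj₂ (copy i))
      ... | inj₁ c∈ = c∈
      ... | inj₂ (inj₁ u , u∈ , inj₁ e) =
        ⊥-elim (indep (inj₂ p) (inj₁ u) p∈ u∈ (inj₁ (trans (≡-sym (blocked-copy p i u)) e)))
      ... | inj₂ (inj₁ u , u∈ , inj₂ (x , h)) =
        ⊥-elim (indep (inj₂ p) (inj₁ u) p∈ u∈ (inj₂ (x , λ v v∈ → trans (≡-sym (blocked-copy p i v)) (h v v∈))))

    -- The blocker of the token set of `X` must be dominated by a token of that very set, which only
    -- the second clause of `Attached` permits. So `X` contains some `φ x`, and a further token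
    -- would be adjacent to the witness that `maximal` provides against it.
    blocker∉⇒Φ : (∀ p → vtx (inj₂ p) ∉ˢ X) → ∃[ x ] Φ x ≡ X
    blocker∉⇒Φ none with dom (inj₂ (blocker (λ u → lookup X (vtx (inj₁ u))) zero))
    ... | inj₁ b∈ = ⊥-elim (none _ b∈)
    ... | inj₂ (inj₂ p , p∈ , _) = ⊥-elim (none _ p∈)
    ... | inj₂ (inj₁ u , u∈ , inj₁ e) =
      ⊥-elim (true≢false ([]=⇒lookup u∈) (trans (≡-sym (blocked-blocker _ zero u)) e))
    ... | inj₂ (inj₁ _ , _ , inj₂ (x , h)) =
      x , lookup-extensional (Φ x) X (λ i → trans (lookup-Φ x i)
            (trans (agree (splitAt N i)) (cong (lookup X) (vtx-split i))))
      where
      φ⊆X : ∀ v → φ x v ≡ true → vtx (inj₁ v) ∈ˢ X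
      φ⊆X v v∈ = lookup⇒[]= _ X (trans (≡-sym (blocked-blocker _ zero v)) (h v v∈))
      agree : ∀ i → φ⁺ x i ≡ lookup X (vtx i)
      agree (inj₂ p) = ≡-sym (¬-not λ e → none p (lookup⇒[]= _ X e))
      agree (inj₁ v) with φ x v in eq
      ... | true = ≡-sym ([]=⇒lookup (φ⊆X v eq))
      ... | false = ≡-sym (¬-not λ e →
        let u , u∈ , apart = maximal x v eq in
        indep (inj₁ v) (inj₁ u) (lookup⇒[]= _ X e) (φ⊆X u u∈)
          (separated (φ x) u∈ eq , λ w (wv , wu) → true≢false wv (apart w wu)))

    indepDom-cases : copies ≤ ∣ X ∣ ⊎ ∃[ x ] Φ x ≡ X
    indepDom-cases with any? (λ p → lookup X (vtx (inj₂ p)) ≟ᵇ true)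
    ... | yes (p , p∈) = inj₁ (blocker∈⇒large p (lookup⇒[]= _ X p∈))
    ... | no none = inj₂ (blocker∉⇒Φ λ p p∈ → none (p , []=⇒lookup p∈))

  ∣Φ∣≤N : ∀ x → ∣ Φ x ∣ ≤ N
  ∣Φ∣≤N x = ≤-trans (≤-reflexive (∣Φ∣ x)) (∣p∣≤n (tabulate (φ x)))

  Φ-iset : ∀ x → ISet G (Φ x)
  Φ-iset x = Φ-indepDom x , minimum
    where
    minimum : ∀ X → IndepDom G X → ∣ Φ x ∣ ≤ ∣ X ∣
    minimum X X-id with indepDom-cases X X-id
    ... | inj₁ large = ≤-trans (∣Φ∣≤N x) (≤-trans (n≤1+n N) large)
    ... | inj₂ (y , refl) = ≤-reflexive (trans (∣Φ∣ x) (trans (same-size x y) (≡-sym (∣Φ∣ y))))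

  -- Comparison with `Φ x₀` bounds an i-set by N, one less than the number of copies of a blocker.
  iset⇒Φ : ∀ X → ISet G X → ∃[ x ] Φ x ≡ X
  iset⇒Φ X (X-id , X-min) with indepDom-cases X X-id
  ... | inj₂ r = r
  ... | inj₁ large = ⊥-elim (<-irrefl refl (≤-trans large (≤-trans (X-min (Φ x₀) (Φ-indepDom x₀)) (∣Φ∣≤N x₀))))

  φ≗Φ : ∀ {x y} → Φ x ≡ Φ y → ∀ u → φ x u ≡ φ y u
  φ≗Φ {x} {y} eq u = trans (≡-sym (at x)) (trans (cong (λ X → lookup X (vtx (inj₁ u))) eq) (at y))
    where
    at : ∀ x → lookup (Φ x) (vtx (inj₁ u)) ≡ φ x u
    at x = trans (lookup-Φ x (vtx (inj₁ u))) (cong (φ⁺ x) (split-vtx (inj₁ u)))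

  Φ-injective : ∀ x y → Φ x ≡ Φ y → x ≡ y
  Φ-injective x y eq with x ≟ᶠ y
  ... | yes x≡y = x≡y
  ... | no x≢y with A x y in xy
  ...   | true = let slide a _ p q _ _ _ = adjacent x y xy in
                 ⊥-elim (true≢false p (trans (φ≗Φ eq a) q))
  ...   | false = let a , _ , _ , (p , q) , _ = distant x y xy x≢y in
                  ⊥-elim (true≢false p (trans (φ≗Φ eq a) q))

  slide⇒adj : ∀ x y → Slide (φ x) (φ y) → ISetAdj G (Φ x) (Φ y)
  slide⇒adj x y (slide a d xa ya xd yd rest) =
    vtx (inj₁ a) , vtx (inj₁ d) , ⇒∈Φ x (inj₁ a) xa ,
    (λ d∈ → true≢false (trans (cong (φ⁺ x) (≡-sym (split-vtx (inj₁ d)))) (∈Φ⇒ x d∈)) xd) ,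
    E⇒adj (inj₁ a) (inj₁ d) (a≢d , apart) ,
    lookup-extensional _ _ λ i → subst (λ i → lookup (Φ y) i ≡ lookup Z i) (vtx-split i) (agree (splitAt N i))
    where
    Z : Subset (N + blockers)
    Z = (Φ x [ vtx (inj₁ a) ]≔ outside) [ vtx (inj₁ d) ]≔ inside
    a≢d : a ≢ d
    a≢d = separated (φ x) xa xd ∘ ≡-sym
    -- By `maximal` some token of `x` never meets `d`. All tokens of `x` except `a` stay in `y` and
    -- meet `d` there, so that token is `a`.
    apart : ∀ w → ¬ (φ w a ≡ true × φ w d ≡ true)
    apart w (wa , wd) with maximal x d xd
    ... | u , xu , h with u ≟ᶠ a
    ...   | yes refl = true≢false wd (h w wa)
    ...   | no u≢a = true≢false yd (h y (trans (≡-sym (rest u u≢a (separated (φ x) xu xd ∘ ≡-sym))) xu))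
    at : ∀ x i → lookup (Φ x) (vtx i) ≡ φ⁺ x i
    at x i = trans (lookup-Φ x (vtx i)) (cong (φ⁺ x) (split-vtx i))
    vtx-injective : ∀ {i j} → vtx i ≡ vtx j → i ≡ j
    vtx-injective {i} {j} eq = trans (≡-sym (split-vtx i)) (trans (cong (splitAt N) eq) (split-vtx j))
    agree-rest : ∀ i → i ≢ inj₁ a → i ≢ inj₁ d → φ⁺ x i ≡ φ⁺ y i
    agree-rest (inj₁ u) u≢a u≢d = rest u (u≢a ∘ cong inj₁) (u≢d ∘ cong inj₁)
    agree-rest (inj₂ p) _ _ = refl
    agree : ∀ i → lookup (Φ y) (vtx i) ≡ lookup Z (vtx i)
    agree i with vtx i ≟ᶠ vtx (inj₁ d) | vtx i ≟ᶠ vtx (inj₁ a)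
    ... | yes eq | _ rewrite vtx-injective {i} {inj₁ d} eq =
      trans (at y (inj₁ d)) (trans yd (≡-sym (moved-to (Φ x))))
    ... | no i≢d | yes eq rewrite vtx-injective {i} {inj₁ a} eq =
      trans (at y (inj₁ a)) (trans ya (≡-sym (moved-from (Φ x) i≢d)))
    ... | no i≢d | no i≢a =
      trans (at y i) (trans (≡-sym (agree-rest i (i≢a ∘ cong vtx) (i≢d ∘ cong vtx))) (trans (≡-sym (at x i))
        (≡-sym (moved-rest (Φ x) i≢a i≢d))))

  adj⇒A : ∀ x y → ISetAdj G (Φ x) (Φ y) → A x y ≡ true
  adj⇒A x y (u , v , u∈ , v∉ , _ , eq) with A x y in xy
  ... | true = refl
  ... | false with x ≟ᶠ y
  ...   | yes refl = ⊥-elim (v∉ (subst (v ∈ˢ_) (≡-sym eq) (lookup⇒[]= v (moved (Φ x)) (moved-to (Φ x)))))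
  ...   | no x≢y with distant x y xy x≢y
  ...     | a , b , a≢b , pa , pb = ⊥-elim (a≢b (↑ˡ-injective blockers a b (trans (only-u a pa) (≡-sym (only-u b pb)))))
    where
    at : ∀ x u → lookup (Φ x) (vtx (inj₁ u)) ≡ φ x u
    at x u = trans (lookup-Φ x (vtx (inj₁ u))) (cong (φ⁺ x) (split-vtx (inj₁ u)))
    only-u : ∀ w → φ x w ≡ true × φ y w ≡ false → vtx (inj₁ w) ≡ u
    only-u w (xw , yw) with vtx (inj₁ w) ≟ᶠ u | vtx (inj₁ w) ≟ᶠ v
    ... | yes p | _ = p
    ... | no _ | yes refl = ⊥-elim (v∉ (lookup⇒[]= v (Φ x) (trans (at x w) xw)))
    ... | no w≢u | no w≢v = ⊥-elim (true≢false xw (trans (≡-sym (at x w)) (trans (≡-sym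
      (trans (cong (λ X → lookup X (vtx (inj₁ w))) eq) (moved-rest (Φ x) w≢u w≢v)))
      (trans (at y w) yw))))

  isIGraph : IsIGraph m A
  isIGraph = G , Φ , Φ-iset , Φ-injective , iset⇒Φ ,
    λ x y → mk⇔ (slide⇒adj x y ∘ adjacent x y) (adj⇒A x y)

-- Boolean list functions and their meaning

any⇒ : ∀ {X : Set} (p : X → Bool) xs → any p xs ≡ true → ∃[ x ] (x ∈ xs × p x ≡ true)
any⇒ p (x ∷ xs) e with p x in px
... | true = x , here refl , px
... | false = let y , y∈ , py = any⇒ p xs e in y , there y∈ , py

⇒any : ∀ {X : Set} (p : X → Bool) {xs x} → x ∈ xs → p x ≡ true → any p xs ≡ true
⇒any p (here refl) px rewrite px = refl
⇒any p {y ∷ _} (there x∈) px with p y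
... | true = refl
... | false = ⇒any p x∈ px

all⇒ : ∀ {X : Set} (p : X → Bool) {xs x} → all p xs ≡ true → x ∈ xs → p x ≡ true
all⇒ p e (here refl) = proj₁ (∧-true e)
all⇒ p e (there x∈) = all⇒ p (proj₂ (∧-true e)) x∈

⇒all : ∀ {X : Set} (p : X → Bool) xs → (∀ {x} → x ∈ xs → p x ≡ true) → all p xs ≡ true
⇒all p [] h = refl
⇒all p (x ∷ xs) h rewrite h (here refl) = ⇒all p xs (h ∘ there)

∈-filterᵇ⁺ : ∀ {X : Set} (p : X → Bool) {xs x} → x ∈ xs → p x ≡ true → x ∈ filterᵇ p xs
∈-filterᵇ⁺ p (here refl) px rewrite px = here refl
∈-filterᵇ⁺ p {y ∷ _} (there x∈) px with p y
... | true = there (∈-filterᵇ⁺ p x∈ px)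
... | false = ∈-filterᵇ⁺ p x∈ px

∈-filterᵇ⁻ : ∀ {X : Set} (p : X → Bool) xs {x} → x ∈ filterᵇ p xs → p x ≡ true
∈-filterᵇ⁻ p (y ∷ xs) x∈ with p y in py
∈-filterᵇ⁻ p (y ∷ xs) (here refl) | true = py
∈-filterᵇ⁻ p (y ∷ xs) (there x∈) | true = ∈-filterᵇ⁻ p xs x∈
... | false = ∈-filterᵇ⁻ p xs x∈

-- Conditions forced on an i-graph

record TokenFamily (m : ℕ) (A : Fin m → Fin m → Bool) : Set where
  field
    {tokens} : ℕ
    mem : Fin m → Fin tokens → Bool

  Leaves : Fin m → Fin m → Fin tokens → Set
  Leaves x y u = mem x u ≡ true × mem y u ≡ false

  AtMostOneLeaves : Fin m → Fin m → Set
  AtMostOneLeaves x y = ∀ {u v} → Leaves x y u → Leaves x y v → u ≡ v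

  field
    leaving  : ∀ x y → A x y ≡ true → ∃ (Leaves x y)
    unique   : ∀ x y → A x y ≡ true → AtMostOneLeaves x y
    near     : ∀ x y → x ≢ y → AtMostOneLeaves x y → AtMostOneLeaves y x → A x y ≡ true
    maximal  : ∀ x v → mem x v ≡ false →
               ∃[ u ] mem x u ≡ true × (∀ w → mem w u ≡ true → mem w v ≡ false)

iGraph⇒family : ∀ {m A} → IsIGraph m A → TokenFamily m A
iGraph⇒family {m} {A} (G , φ , isets , φ-inj , _ , φ-adj) = record
  { mem = mem
  ; leaving = λ x y xy → let u , p , _ = step x y xy in u , p
  ; unique = λ x y xy p q → let u , _ , only = step x y xy in trans (only p) (≡-sym (only q))
  ; near = near
  ; maximal = maximal
  }
  where
  mem : Fin m → Fin (n G) → Bool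
  mem x u = lookup (φ x) u

  independent : ∀ x u v → mem x u ≡ true → mem x v ≡ true → adj G u v ≡ false
  independent x u v p q = proj₁ (proj₁ (isets x)) u v (lookup⇒[]= u _ p) (lookup⇒[]= v _ q)

  dominated : ∀ x v → mem x v ≡ false → ∃[ u ] (mem x u ≡ true × adj G v u ≡ true)
  dominated x v v∉ with proj₂ (proj₁ (isets x)) v
  ... | inj₁ v∈ = ⊥-elim (true≢false ([]=⇒lookup v∈) v∉)
  ... | inj₂ (u , u∈ , e) = u , []=⇒lookup u∈ , e

  maximal : ∀ x v → mem x v ≡ false → ∃[ u ] mem x u ≡ true × (∀ w → mem w u ≡ true → mem w v ≡ false)
  maximal x v v∉ = let u , u∈ , e = dominated x v v∉ in
    u , u∈ , λ w wu → ¬-not λ wv → true≢false e (independent w v u wv wu)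

  step : ∀ x y → A x y ≡ true → ∃[ u ] (mem x u ≡ true × mem y u ≡ false) ×
         (∀ {w} → mem x w ≡ true × mem y w ≡ false → w ≡ u)
  step x y xy with Equivalence.to (φ-adj x y) xy
  ... | u , v , u∈ , v∉ , _ , eq =
    u , ([]=⇒lookup u∈ , trans (at u) (moved-from (φ x) u≢v)) , only
    where
    at : ∀ w → mem y w ≡ lookup (moved (φ x) {u} {v}) w
    at w = cong (λ Y → lookup Y w) eq
    u≢v : u ≢ v
    u≢v refl = v∉ u∈
    only : ∀ {w} → mem x w ≡ true × mem y w ≡ false → w ≡ u
    only {w} (xw , yw) with w ≟ᶠ u | w ≟ᶠ v
    ... | yes p | _ = p
    ... | no _ | yes refl = ⊥-elim (v∉ (lookup⇒[]= w _ xw))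
    ... | no w≢u | no w≢v =
      ⊥-elim (true≢false (trans (at w) (trans (moved-rest (φ x) w≢u w≢v) xw)) yw)

  -- Independence of `φ y` keeps shared tokens from dominating the token `d` that only `y` holds, so
  -- `d` is adjacent to the one token `a` that only `x` holds: this is the slide. A difference on
  -- one side only would leave the extra token undominated.
  near : ∀ x y → x ≢ y →
         (∀ {u v} → mem x u ≡ true × mem y u ≡ false → mem x v ≡ true × mem y v ≡ false → u ≡ v) →
         (∀ {u v} → mem y u ≡ true × mem x u ≡ false → mem y v ≡ true × mem x v ≡ false → u ≡ v) →
         A x y ≡ true
  near x y x≢y out in′ with any? (λ u → (mem x u ≟ᵇ true) ×-dec (mem y u ≟ᵇ false))
                          | any? (λ u → (mem y u ≟ᵇ true) ×-dec (mem x u ≟ᵇ false))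
  ... | no ¬out | no ¬in = ⊥-elim (x≢y (φ-inj x y (lookup-extensional (φ x) (φ y) same)))
    where
    same : ∀ u → mem x u ≡ mem y u
    same u with mem x u in xu | mem y u in yu
    ... | true | true = refl
    ... | false | false = refl
    ... | true | false = ⊥-elim (¬out (u , xu , yu))
    ... | false | true = ⊥-elim (¬in (u , yu , xu))
  ... | yes (a , xa , ya) | no ¬in =
    let d , yd , e = dominated y a ya in
    ⊥-elim (¬in (d , yd , ¬-not λ xd → true≢false e (independent x a d xa xd)))
  ... | no ¬out | yes (d , yd , xd) =
    let a , xa , e = dominated x d xd in
    ⊥-elim (¬out (a , xa , ¬-not λ ya → true≢false e (independent y d a yd ya)))
  ... | yes (a , xa , ya) | yes (d , yd , xd) =
    Equivalence.from (φ-adj x y) (a , d , lookup⇒[]= a _ xa , (λ d∈ → true≢false ([]=⇒lookup d∈) xd) , edge ,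
      lookup-extensional (φ y) (moved (φ x)) agree)
    where
    edge : adj G a d ≡ true
    edge with dominated x d xd
    ... | u , xu , e with mem y u in yu
    ...   | true = ⊥-elim (true≢false e (independent y d u yd yu))
    ...   | false rewrite out {a} {u} (xa , ya) (xu , yu) = trans (Graph.sym G u d) e
    agree : ∀ w → mem y w ≡ lookup (moved (φ x) {a} {d}) w
    agree w with w ≟ᶠ d | w ≟ᶠ a
    ... | yes refl | _ = trans yd (≡-sym (moved-to (φ x)))
    ... | no w≢d | yes refl = trans ya (≡-sym (moved-from (φ x) w≢d))
    ... | no w≢d | no w≢a = trans same (≡-sym (moved-rest (φ x) w≢a w≢d))
      where
      same : mem y w ≡ mem x w
      same with mem x w in xw | mem y w in yw
      ... | true | true = refl
      ... | false | false = refl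
      ... | true | false = ⊥-elim (w≢a (out (xw , yw) (xa , ya)))
      ... | false | true = ⊥-elim (w≢d (in′ (yw , xw) (yd , xd)))

allColumns : ∀ m → List (Vec Bool m)
allColumns zero = [] ∷ []
allColumns (suc m) = map (true ∷_) (allColumns m) ++ map (false ∷_) (allColumns m)

∈-allColumns : ∀ {m} (c : Vec Bool m) → c ∈ allColumns m
∈-allColumns [] = here refl
∈-allColumns (true ∷ c) = ∈-++⁺ˡ (∈-map⁺ (true ∷_) (∈-allColumns c))
∈-allColumns {suc m} (false ∷ c) = ∈-++⁺ʳ (map (true ∷_) (allColumns m)) (∈-map⁺ (false ∷_) (∈-allColumns c))

-- Exact-cover search

module Search {m : ℕ} where

  Column Pair : Set
  Column = Vec Bool m
  Pair   = Fin m × Fin m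

  leaves : Pair → Column → Bool
  leaves (x , y) c = lookup c x ∧ not (lookup c y)

  clash : List Pair → Column → Column → Bool
  clash edges c c′ = any (λ e → leaves e c ∧ leaves e c′) edges

  meets : Column → Column → Bool
  meets c c′ = any (λ x → lookup c x ∧ lookup c′ x) (allFin m)

  atMostOne : Pair → List Column → Bool
  atMostOne e [] = true
  atMostOne e (c ∷ cs) = if leaves e c then not (any (leaves e) cs) else atMostOne e cs

  -- An open column leaving `e` could still belong to a token, so it counts against the bound.
  few : Pair → List Column → List Column → Bool
  few e chosen open′ = atMostOne e chosen ∧ not (any (leaves e) open′)

  tooClose : List Pair → List Column → List Column → Bool
  tooClose apart chosen open′ =
    any (λ (x , y) → few (x , y) chosen open′ ∧ few (y , x) chosen open′) apart

  -- Open columns are included, since any of them could be the token that witnesses maximality at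
  -- `x`.
  extendable : List Column → List Column → Fin m → Column → Bool
  extendable chosen open′ x v =
    not (lookup v x) ∧ all (λ c → not (lookup c x) ∨ meets c v) (chosen ++ open′)

  notMaximal : List Column → List Column → Bool
  notMaximal chosen open′ = any (λ x → any (extendable chosen open′ x) chosen) (allFin m)

  -- chosen holds the columns of the tokens found so far, open′ the columns that
  -- the other tokens may still have; each directed edge is left by one token.
  module _ (edges apart : List Pair) where
    refute : List Pair → List Column → List Column → Bool
    -- All directed edges are now left by chosen columns. Open columns clash with none of these, so
    -- they leave no edge; on a theta graph only the two constant columns qualify.
    refute [] chosen open′ = notMaximal chosen open′ ∨ tooClose apart chosen open′
    refute (e ∷ es) chosen open′ =
      if any (leaves e) chosen then refute es chosen open′
      else all (λ c → not (leaves e c) ∨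
                      refute es (c ∷ chosen) (filterᵇ (not ∘ clash edges c) open′)) open′

  Triple : Set
  Triple = Fin m × Fin m × Fin m

  -- For a path x y z with x, z non-adjacent, no token is held by exactly y or by
  -- exactly x and z among the three: otherwise x and z would be one slide apart.
  consistent : List Triple → Column → Bool
  consistent ts c = all (λ (x , y , z) →
    not ((lookup c x xor lookup c y) ∧ (lookup c y xor lookup c z))) ts

  module _ (A : Fin m → Fin m → Bool) where
    pairs edges apart : List Pair
    pairs = cartesianProduct (allFin m) (allFin m)
    edges = filterᵇ (λ (x , y) → A x y) pairs
    apart = filterᵇ (λ (x , y) → not (A x y) ∧ not (does (x ≟ᶠ y))) pairs

    triples : List Triple
    triples = filterᵇ (λ (x , y , z) → ((A x y ∧ A y x) ∧ (A y z ∧ A z y)) ∧ (not (A x z) ∧ not (does (x ≟ᶠ z))))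
                (cartesianProduct (allFin m) pairs)

    refuted : Bool
    refuted = refute edges apart edges [] (filterᵇ (consistent triples) (allColumns m))

-- Soundness of the search

not-true : ∀ {b} → not b ≡ true → b ≡ false
not-true {false} refl = refl

not-false : ∀ {b} → b ≡ false → not b ≡ true
not-false refl = refl

∨-true : ∀ {a b} → a ∨ b ≡ true → a ≡ true ⊎ b ≡ true
∨-true {true} _ = inj₁ refl
∨-true {false} e = inj₂ e

does-not : ∀ {m} {x y : Fin m} → not (does (x ≟ᶠ y)) ≡ true → x ≢ y
does-not {x = x} e refl with x ≟ᶠ x
does-not e refl | no p = p refl

module Soundness {m : ℕ} {A : Fin m → Fin m → Bool} (F : TokenFamily m A) where
  open TokenFamily F
  open Search {m}

  column : Fin tokens → Column
  column u = tabulate λ x → mem x u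

  column-at : ∀ u x → lookup (column u) x ≡ mem x u
  column-at u x = lookup∘tabulate (λ x → mem x u) x

  leaves⇒ : ∀ x y u → leaves (x , y) (column u) ≡ true → Leaves x y u
  leaves⇒ x y u e rewrite column-at u x | column-at u y =
    let p , q = ∧-true e in p , not-true q

  ⇒leaves : ∀ {x y u} → Leaves x y u → leaves (x , y) (column u) ≡ true
  ⇒leaves {x} {y} {u} (p , q) rewrite column-at u x | column-at u y | p | q = refl

  edges-sound : ∀ {x y} → (x , y) ∈ edges A → A x y ≡ true
  edges-sound = ∈-filterᵇ⁻ (λ (x , y) → A x y) (pairs A)

  meets⇒ : ∀ {u v} → meets (column u) (column v) ≡ true → ∃[ w ] (mem w u ≡ true × mem w v ≡ true)
  meets⇒ {u} {v} e =
    let w , _ , p = any⇒ (λ x → lookup (column u) x ∧ lookup (column v) x) (allFin m) e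
        q , r = ∧-true p
    in w , trans (≡-sym (column-at u w)) q , trans (≡-sym (column-at v w)) r

  -- Chosen entries are tokens, so that uniqueness can identify them; open entries are mere columns,
  -- which any number of tokens may share.
  Covered : List (Fin tokens) → List Column → Set
  Covered chosen open′ = ∀ u → u ∈ chosen ⊎ column u ∈ open′

  atMostOne-sound : ∀ x y us → atMostOne (x , y) (map column us) ≡ true →
                    ∀ {u v} → u ∈ us → v ∈ us → Leaves x y u → Leaves x y v → u ≡ v
  atMostOne-sound x y (w ∷ us) e u∈ v∈ p q with leaves (x , y) (column w) in lw
  atMostOne-sound x y (w ∷ us) e (here refl) (here refl) p q | true = refl
  atMostOne-sound x y (w ∷ us) e (here refl) (there v∈) p q | true =
    ⊥-elim (true≢false (⇒any (leaves (x , y)) (∈-map⁺ column v∈) (⇒leaves q)) (not-true e))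
  atMostOne-sound x y (w ∷ us) e (there u∈) v∈ p q | true =
    ⊥-elim (true≢false (⇒any (leaves (x , y)) (∈-map⁺ column u∈) (⇒leaves p)) (not-true e))
  atMostOne-sound x y (w ∷ us) e (here refl) _ p q | false = ⊥-elim (true≢false (⇒leaves p) lw)
  atMostOne-sound x y (w ∷ us) e (there _) (here refl) p q | false = ⊥-elim (true≢false (⇒leaves q) lw)
  atMostOne-sound x y (w ∷ us) e (there u∈) (there v∈) p q | false = atMostOne-sound x y us e u∈ v∈ p q

  few-sound : ∀ x y {us cs} → Covered us cs → few (x , y) (map column us) cs ≡ true → AtMostOneLeaves x y
  few-sound x y {us} {cs} cov e {u} {v} p q =
    atMostOne-sound x y us (proj₁ (∧-true e)) (chosen p) (chosen q) p q
    where
    chosen : ∀ {u} → Leaves x y u → u ∈ us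
    chosen {u} p with cov u
    ... | inj₁ u∈ = u∈
    ... | inj₂ c∈ = ⊥-elim (true≢false (⇒any (leaves (x , y)) c∈ (⇒leaves p)) (not-true (proj₂ (∧-true e))))

  tooClose-sound : ∀ {us cs} → Covered us cs → ¬ tooClose (apart A) (map column us) cs ≡ true
  tooClose-sound {us} {cs} cov e =
    let (x , y) , xy∈ , p = any⇒ (λ (x , y) → few (x , y) (map column us) cs ∧ few (y , x) (map column us) cs) (apart A) e
        q , r = ∧-true p
        ¬xy , x≢y = ∧-true (∈-filterᵇ⁻ (λ (x , y) → not (A x y) ∧ not (does (x ≟ᶠ y))) (pairs A) xy∈)
    in true≢false (near x y (does-not x≢y) (few-sound x y cov q) (few-sound y x cov r)) (not-true ¬xy)

  notMaximal-sound : ∀ {us cs} → Covered us cs → ¬ notMaximal (map column us) cs ≡ true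
  notMaximal-sound {us} {cs} cov e =
    let x , _ , p = any⇒ (λ x → any (extendable (map column us) cs x) (map column us)) (allFin m) e
        c , c∈ , q = any⇒ (extendable (map column us) cs x) (map column us) p
        v , _ , c≡ = ∈-map⁻ column c∈
        x∉ , r = ∧-true q
    in go x v (trans (≡-sym (column-at v x)) (trans (cong (λ c → lookup c x) (≡-sym c≡)) (not-true x∉)))
         (subst (λ v → all (λ c → not (lookup c x) ∨ meets c v) (map column us ++ cs) ≡ true) c≡ r)
    where
    go : ∀ x v → mem x v ≡ false →
         ¬ all (λ c → not (lookup c x) ∨ meets c (column v)) (map column us ++ cs) ≡ true
    go x v v∉ r with maximal x v v∉
    ... | u , u∈ , apart-uv = absurd (∨-true (all⇒ (λ c → not (lookup c x) ∨ meets c (column v)) r (member (cov u))))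
      where
      member : u ∈ us ⊎ column u ∈ cs → column u ∈ map column us ++ cs
      member (inj₁ u∈us) = ∈-++⁺ˡ (∈-map⁺ column u∈us)
      member (inj₂ c∈) = ∈-++⁺ʳ (map column us) c∈
      absurd : ¬ (not (lookup (column u) x) ≡ true ⊎ meets (column u) (column v) ≡ true)
      absurd (inj₁ e) = true≢false u∈ (trans (≡-sym (column-at u x)) (not-true e))
      absurd (inj₂ e) = let w , wu , wv = meets⇒ {u} {v} e in true≢false wv (apart-uv w wu)

  -- The token that actually leaves the current edge selects a branch. `Covered` survives there: a
  -- token whose column clashes with that of `u` leaves a common edge with it and equals `u` by
  -- `unique`.
  refute-sound : ∀ es → (∀ {e} → e ∈ es → e ∈ edges A) → ∀ us cs → Covered us cs →
                 ¬ refute (edges A) (apart A) es (map column us) cs ≡ true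
  refute-sound [] _ us cs cov e with ∨-true e
  ... | inj₁ p = notMaximal-sound {us} {cs} cov p
  ... | inj₂ p = tooClose-sound {us} {cs} cov p
  refute-sound ((x , y) ∷ es) es⊆ us cs cov e with any (leaves (x , y)) (map column us) in left
  ... | true = refute-sound es (es⊆ ∘ there) us cs cov e
  ... | false with leaving x y (edges-sound (es⊆ (here refl)))
  ...   | u , lu with cov u
  ...     | inj₁ u∈ = true≢false (⇒any (leaves (x , y)) (∈-map⁺ column u∈) (⇒leaves lu)) left
  ...     | inj₂ c∈ with ∨-true (all⇒ (λ c → not (leaves (x , y) c) ∨
                      refute (edges A) (apart A) es (c ∷ map column us) (filterᵇ (not ∘ clash (edges A) c) cs)) e c∈)
  ...       | inj₁ p = true≢false (⇒leaves lu) (not-true p)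
  ...       | inj₂ p = refute-sound es (es⊆ ∘ there) (u ∷ us) _ cov′ p
    where
    cov′ : Covered (u ∷ us) (filterᵇ (not ∘ clash (edges A) (column u)) cs)
    cov′ v with cov v
    ... | inj₁ v∈ = inj₁ (there v∈)
    ... | inj₂ v∈ with clash (edges A) (column u) (column v) in cl
    ...   | false = inj₂ (∈-filterᵇ⁺ (not ∘ clash (edges A) (column u)) v∈ (not-false cl))
    ...   | true =
      let (x′ , y′) , e∈ , p = any⇒ (λ e → leaves e (column u) ∧ leaves e (column v)) (edges A) cl
          q , r = ∧-true p
      in inj₁ (here (unique x′ y′ (edges-sound e∈) (leaves⇒ x′ y′ v r) (leaves⇒ x′ y′ u q)))

  consistent-sound : ∀ u → consistent (triples A) (column u) ≡ true
  consistent-sound u = ⇒all _ (triples A) λ { {x , y , z} t∈ → at x y z t∈ }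
    where
    at : ∀ x y z → (x , y , z) ∈ triples A →
         not ((lookup (column u) x xor lookup (column u) y) ∧ (lookup (column u) y xor lookup (column u) z)) ≡ true
    at x y z t∈ rewrite column-at u x | column-at u y | column-at u z
      with ∧-true (∈-filterᵇ⁻ _ (cartesianProduct (allFin m) (pairs A)) t∈)
    ... | h₁ , h₂ with ∧-true h₁ | ∧-true h₂
    ... | h₃ , h₄ | ¬xz , x≢z with ∧-true h₃ | ∧-true h₄
    ... | xy , yx | yz , zy with mem x u in xu | mem y u in yu | mem z u in zu
    ... | true  | true  | _     = refl
    ... | false | false | _     = refl
    ... | true  | false | false = refl
    ... | false | true  | true  = refl
    -- A token held by x but not by z is also in y: otherwise it would be `u`, the only token
    -- leaving x for y, which z holds. So it leaves y for z, and only one token does. The same holds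
    -- from z to x.
    ... | true  | false | true  = ⊥-elim (true≢false (near x z (does-not x≢z) out in′) (not-true ¬xz))
      where
      out′ : ∀ {w} → Leaves x z w → Leaves y z w
      out′ {w} (xw , zw) with mem y w in yw
      ... | true = refl , zw
      ... | false with refl ← unique x y xy (xu , yu) (xw , yw) = ⊥-elim (true≢false zu zw)
      out : AtMostOneLeaves x z
      out p q = unique y z yz (out′ p) (out′ q)
      in″ : ∀ {w} → Leaves z x w → Leaves y x w
      in″ {w} (zw , xw) with mem y w in yw
      ... | true = refl , xw
      ... | false with refl ← unique z y zy (zu , yu) (zw , yw) = ⊥-elim (true≢false xu xw)
      in′ : AtMostOneLeaves z x
      in′ p q = unique y x yx (in″ p) (in″ q)
    -- Dually, a token held by x but not by z is not in y: otherwise it would be `u`, the only token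
    -- leaving y for z, which x lacks.
    ... | false | true  | false = ⊥-elim (true≢false (near x z (does-not x≢z) out in′) (not-true ¬xz))
      where
      out′ : ∀ {w} → Leaves x z w → Leaves x y w
      out′ {w} (xw , zw) with mem y w in yw
      ... | false = xw , refl
      ... | true with refl ← unique y z yz (yu , zu) (yw , zw) = ⊥-elim (true≢false xw xu)
      out : AtMostOneLeaves x z
      out p q = unique x y xy (out′ p) (out′ q)
      in″ : ∀ {w} → Leaves z x w → Leaves z y w
      in″ {w} (zw , xw) with mem y w in yw
      ... | false = zw , refl
      ... | true with refl ← unique y x yx (yu , xu) (yw , xw) = ⊥-elim (true≢false zw zu)
      in′ : AtMostOneLeaves z x
      in′ p q = unique z y zy (in″ p) (in″ q)

  refuted-sound : ¬ refuted A ≡ true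
  refuted-sound = refute-sound (edges A) (λ e∈ → e∈) [] _ λ u →
    inj₂ (∈-filterᵇ⁺ (consistent (triples A)) (∈-allColumns (column u)) (consistent-sound u))

not-iGraph : ∀ {m A} → Search.refuted A ≡ true → ¬ IsIGraph m A
not-iGraph e H = Soundness.refuted-sound (iGraph⇒family H) e

-- Theta graphs as three glued paths

-- Positions relative to a path with p internal vertices; off stands for the
-- vertices outside the path.
data Pos (p : ℕ) : Set where
  src tgt off : Pos p
  mid : Fin p → Pos p

step : ∀ {p} → Pos p → Pos p → Bool
step {p} src     tgt     = 0 ≡ᵇ p
step     src     (mid i) = 0 ≡ᵇ toℕ i
step {p} (mid i) tgt     = suc (toℕ i) ≡ᵇ p
step     (mid i) (mid j) = suc (toℕ i) ≡ᵇ toℕ j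
step     _       _       = false

-- The vertices of θ_{p+1,q+1,r+1}: p, q, r count internal vertices.
data V (p q r : ℕ) : Set where
  s t : V p q r
  a : Fin p → V p q r
  b : Fin q → V p q r
  c : Fin r → V p q r

π₁ : ∀ {p q r} → V p q r → Pos p
π₁ s = src
π₁ t = tgt
π₁ (a i) = mid i
π₁ (b _) = off
π₁ (c _) = off

π₂ : ∀ {p q r} → V p q r → Pos q
π₂ s = src
π₂ t = tgt
π₂ (a _) = off
π₂ (b i) = mid i
π₂ (c _) = off

π₃ : ∀ {p q r} → V p q r → Pos r
π₃ s = src
π₃ t = tgt
π₃ (a _) = off
π₃ (b _) = off
π₃ (c i) = mid i

directed : ∀ {p q r} → V p q r → V p q r → Bool
directed u v = step (π₁ u) (π₁ v) ∨ (step (π₂ u) (π₂ v) ∨ step (π₃ u) (π₃ v))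

θ : ∀ {p q r} → V p q r → V p q r → Bool
θ u v = directed u v ∨ directed v u

θ-sym : ∀ {p q r} (u v : V p q r) → θ u v ≡ θ v u
θ-sym u v = ∨-comm (directed u v) (directed v u)

infix 4 _≟_
_≟_ : ∀ {p q r} → DecidableEquality (V p q r)
s ≟ s = yes refl
t ≟ t = yes refl
a i ≟ a j = map′ (cong a) (λ { refl → refl }) (i ≟ᶠ j)
b i ≟ b j = map′ (cong b) (λ { refl → refl }) (i ≟ᶠ j)
c i ≟ c j = map′ (cong c) (λ { refl → refl }) (i ≟ᶠ j)
s ≟ t = no λ ()
s ≟ a _ = no λ ()
s ≟ b _ = no λ ()
s ≟ c _ = no λ ()
t ≟ s = no λ ()
t ≟ a _ = no λ ()
t ≟ b _ = no λ ()
t ≟ c _ = no λ ()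
a _ ≟ s = no λ ()
a _ ≟ t = no λ ()
a _ ≟ b _ = no λ ()
a _ ≟ c _ = no λ ()
b _ ≟ s = no λ ()
b _ ≟ t = no λ ()
b _ ≟ a _ = no λ ()
b _ ≟ c _ = no λ ()
c _ ≟ s = no λ ()
c _ ≟ t = no λ ()
c _ ≟ a _ = no λ ()
c _ ≟ b _ = no λ ()

-- Agreement with the numbered edge lists

any-∨ : ∀ {X : Set} (f g : X → Bool) xs → any (λ x → f x ∨ g x) xs ≡ any f xs ∨ any g xs
any-∨ f g [] = refl
any-∨ f g (x ∷ xs) rewrite any-∨ f g xs with f x | g x
... | true  | _     = refl
... | false | false = refl
... | false | true with any f xs
...   | true  = refl
...   | false = refl

any-++ : ∀ {X : Set} (f : X → Bool) xs ys → any f (xs ++ ys) ≡ any f xs ∨ any f ys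
any-++ f [] ys = refl
any-++ f (x ∷ xs) ys rewrite any-++ f xs ys = ≡-sym (∨-assoc (f x) (any f xs) (any f ys))

≡ᵇ-refl : ∀ m → (m ≡ᵇ m) ≡ true
≡ᵇ-refl zero = refl
≡ᵇ-refl (suc m) = ≡ᵇ-refl m

≢⇒≡ᵇ : ∀ {m n} → m ≢ n → (m ≡ᵇ n) ≡ false
≢⇒≡ᵇ {zero} {zero} ne = ⊥-elim (ne refl)
≢⇒≡ᵇ {zero} {suc n} ne = refl
≢⇒≡ᵇ {suc m} {zero} ne = refl
≢⇒≡ᵇ {suc m} {suc n} ne = ≢⇒≡ᵇ (ne ∘ cong suc)

fwd : ℕ → ℕ → ℕ × ℕ → Bool
fwd m n (u , v) = (u ≡ᵇ m) ∧ (v ≡ᵇ n)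

-- Number m lies at the given position of the path of pathEdges o 1 f (suc p).
Enc : ℕ → ℕ → ∀ {p} → Pos p → ℕ → Set
Enc o f src m = m ≡ o
Enc o f tgt m = m ≡ 1
Enc o f (mid i) m = m ≡ f + toℕ i
Enc o f {p} off m = m ≢ o × m ≢ 1 × (m < f ⊎ f + p ≤ m)

isSrc isFirst : ∀ {p} → Pos p → Bool
isSrc src = true
isSrc _ = false
isFirst (mid zero) = true
isFirst _ = false

-- This cuts off the first edge: the first internal vertex becomes the source and the old source
-- falls off the path, as in the recursion of `pathEdges`.
tail : ∀ {p} → Pos (suc p) → Pos p
tail src = off
tail tgt = tgt
tail off = off
tail (mid zero) = src
tail (mid (suc i)) = mid i

step-tail : ∀ {p} (x y : Pos (suc p)) → step x y ≡ (isSrc x ∧ isFirst y) ∨ step (tail x) (tail y)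
step-tail src src = refl
step-tail src tgt = refl
step-tail src off = refl
step-tail src (mid zero) = refl
step-tail src (mid (suc i)) = refl
step-tail tgt src = refl
step-tail tgt tgt = refl
step-tail tgt off = refl
step-tail tgt (mid zero) = refl
step-tail tgt (mid (suc i)) = refl
step-tail off src = refl
step-tail off tgt = refl
step-tail off off = refl
step-tail off (mid zero) = refl
step-tail off (mid (suc i)) = refl
step-tail (mid zero) src = refl
step-tail (mid zero) tgt = refl
step-tail (mid zero) off = refl
step-tail (mid zero) (mid zero) = refl
step-tail (mid zero) (mid (suc i)) = refl
step-tail (mid (suc i)) src = refl
step-tail (mid (suc i)) tgt = refl
step-tail (mid (suc i)) off = refl
step-tail (mid (suc i)) (mid zero) = refl
step-tail (mid (suc i)) (mid (suc j)) = refl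

module _ {o f : ℕ} (o≢1 : o ≢ 1) (o<f : o < f) (2≤f : 2 ≤ f) where
  f≢1 : f ≢ 1
  f≢1 f≡1 = <-irrefl (≡-sym f≡1) 2≤f

  o≢f : o ≢ f
  o≢f o≡f = <-irrefl o≡f o<f

  enc-src : ∀ {p} (x : Pos p) {m} → Enc o f x m → (o ≡ᵇ m) ≡ isSrc x
  enc-src src refl = ≡ᵇ-refl o
  enc-src tgt refl = ≢⇒≡ᵇ o≢1
  enc-src off (m≢o , _) = ≢⇒≡ᵇ (m≢o ∘ ≡-sym)
  enc-src (mid i) refl = ≢⇒≡ᵇ λ { e → <-irrefl refl (≤-trans o<f (≤-trans (m≤m+n f (toℕ i)) (≤-reflexive (≡-sym e)))) }

  enc-first : ∀ {p} (x : Pos (suc p)) {m} → Enc o f x m → (f ≡ᵇ m) ≡ isFirst x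
  enc-first src refl = ≢⇒≡ᵇ (o≢f ∘ ≡-sym)
  enc-first tgt refl = ≢⇒≡ᵇ f≢1
  enc-first off {m} (_ , _ , inj₁ m<f) = ≢⇒≡ᵇ {f} {m} λ { refl → <-irrefl refl m<f }
  enc-first {p} off {m} (_ , _ , inj₂ f+p≤m) =
    ≢⇒≡ᵇ {f} {m} λ { refl → <-irrefl refl (≤-trans (s≤s (m≤m+n f p)) (≤-trans (≤-reflexive (≡-sym (+-suc f p))) f+p≤m)) }
  enc-first (mid zero) refl rewrite +-identityʳ f = ≡ᵇ-refl f
  enc-first (mid (suc i)) refl =
    ≢⇒≡ᵇ λ e → <-irrefl e (≤-trans (s≤s (m≤m+n f (toℕ i))) (≤-reflexive (≡-sym (+-suc f (toℕ i)))))

  enc-tail : ∀ {p} (x : Pos (suc p)) {m} → Enc o f x m → Enc f (suc f) (tail x) m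
  enc-tail src refl = o≢f , o≢1 , inj₁ (m≤n⇒m≤1+n o<f)
  enc-tail tgt e = e
  enc-tail off (_ , m≢1 , inj₁ m<f) = (λ { refl → <-irrefl refl m<f }) , m≢1 , inj₁ (m≤n⇒m≤1+n m<f)
  enc-tail {p} off {m} (_ , m≢1 , inj₂ f+p≤m) =
    (λ { refl → <-irrefl refl (≤-trans (s≤s (m≤m+n f p)) h) }) , m≢1 , inj₂ h
    where
    h : suc (f + p) ≤ m
    h = ≤-trans (≤-reflexive (≡-sym (+-suc f p))) f+p≤m
  enc-tail (mid zero) e = trans e (+-identityʳ f)
  enc-tail (mid (suc i)) e = trans e (+-suc f (toℕ i))

-- The source number `o` is kept general because each recursive step makes `f` the new source;
-- `o < f` keeps past sources below the interval of internal vertices.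
path-step : ∀ {o f} p → o ≢ 1 → o < f → 2 ≤ f → (x y : Pos p) → ∀ {m n} → Enc o f x m → Enc o f y n →
            any (fwd m n) (pathEdges o 1 f (suc p)) ≡ step x y
path-step {o} {f} (suc p) o≢1 o<f 2≤f x y ex ey
  rewrite enc-src o≢1 o<f 2≤f x ex | enc-first o≢1 o<f 2≤f y ey
        | path-step p (f≢1 o≢1 o<f 2≤f) ≤-refl (m≤n⇒m≤1+n 2≤f) (tail x) (tail y)
            (enc-tail o≢1 o<f 2≤f x ex) (enc-tail o≢1 o<f 2≤f y ey) = ≡-sym (step-tail x y)
path-step zero o≢1 o<f 2≤f x y {m} {n} ex ey rewrite enc-src o≢1 o<f 2≤f x ex = go x y ey
  where
  go : ∀ (x y : Pos 0) → Enc _ _ y n → (isSrc x ∧ (1 ≡ᵇ n)) ∨ false ≡ step x y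
  go src src refl rewrite ≢⇒≡ᵇ (o≢1 ∘ ≡-sym) = refl
  go src tgt refl = refl
  go src off (_ , n≢1 , _) rewrite ≢⇒≡ᵇ (n≢1 ∘ ≡-sym) = refl
  go tgt _ _ = refl
  go off _ _ = refl

module _ {p q r : ℕ} where
  f₂ f₃ : ℕ
  f₂ = suc (suc p)
  f₃ = suc p + suc q

  code : V p q r → ℕ
  code s = 0
  code t = 1
  code (a i) = 2 + toℕ i
  code (b i) = f₂ + toℕ i
  code (c i) = f₃ + toℕ i

  f₃≡ : f₃ ≡ f₂ + q
  f₃≡ = +-suc (suc p) q

  f₂≤f₃ : f₂ ≤ f₃
  f₂≤f₃ = ≤-trans (m≤m+n f₂ q) (≤-reflexive (≡-sym f₃≡))

  2≤f₃ : 2 ≤ f₃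
  2≤f₃ = ≤-trans (s≤s (s≤s z≤n)) f₂≤f₃

  ≢1 : ∀ {m} → 2 ≤ m → m ≢ 1
  ≢1 2≤m m≡1 = <-irrefl (≡-sym m≡1) 2≤m

  enc₁ : ∀ v → Enc 0 2 (π₁ v) (code v)
  enc₁ s = refl
  enc₁ t = refl
  enc₁ (a i) = refl
  enc₁ (b i) = (λ ()) , (λ ()) , inj₂ (m≤m+n f₂ (toℕ i))
  enc₁ (c i) = (λ ()) , ≢1 (≤-trans 2≤f₃ (m≤m+n f₃ (toℕ i))) , inj₂ (≤-trans f₂≤f₃ (m≤m+n f₃ (toℕ i)))

  enc₂ : ∀ v → Enc 0 f₂ (π₂ v) (code v)
  enc₂ s = refl
  enc₂ t = refl
  enc₂ (a i) = (λ ()) , (λ ()) , inj₁ (s≤s (s≤s (toℕ<n i)))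
  enc₂ (b i) = refl
  enc₂ (c i) = (λ ()) , ≢1 (≤-trans 2≤f₃ (m≤m+n f₃ (toℕ i))) , inj₂ (≤-trans (≤-reflexive (≡-sym f₃≡)) (m≤m+n f₃ (toℕ i)))

  enc₃ : ∀ v → Enc 0 f₃ (π₃ v) (code v)
  enc₃ s = refl
  enc₃ t = refl
  enc₃ (a i) = (λ ()) , (λ ()) , inj₁ (≤-trans (s≤s (s≤s (toℕ<n i))) f₂≤f₃)
  enc₃ (b i) = (λ ()) , (λ ()) , inj₁ (≤-trans (+-monoʳ-< f₂ (toℕ<n i)) (≤-reflexive (≡-sym f₃≡)))
  enc₃ (c i) = refl

  directed-code : ∀ u v → any (fwd (code u) (code v)) (thetaEdges (suc p) (suc q) (suc r)) ≡ directed u v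
  directed-code u v
    rewrite any-++ (fwd (code u) (code v)) (pathEdges 0 1 2 (suc p)) (pathEdges 0 1 f₂ (suc q) ++ pathEdges 0 1 f₃ (suc r))
          | any-++ (fwd (code u) (code v)) (pathEdges 0 1 f₂ (suc q)) (pathEdges 0 1 f₃ (suc r))
          | path-step p (λ ()) (s≤s z≤n) (s≤s (s≤s z≤n)) (π₁ u) (π₁ v) (enc₁ u) (enc₁ v)
          | path-step q (λ ()) (s≤s z≤n) (s≤s (s≤s z≤n)) (π₂ u) (π₂ v) (enc₂ u) (enc₂ v)
          | path-step r (λ ()) (s≤s z≤n) 2≤f₃ (π₃ u) (π₃ v) (enc₃ u) (enc₃ v) = refl

  within : ∀ f l x → f ≤ x → x < f + l → ∃[ i ] x ≡ f + toℕ {l} i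
  within zero l x _ x<l = fromℕ< x<l , ≡-sym (toℕ-fromℕ< x<l)
  within (suc f) l (suc x) (s≤s f≤x) (s≤s x<) = let i , e = within f l x f≤x x< in i , cong suc e

  decode : ∀ x → x < p + suc q + suc r → ∃[ v ] code v ≡ x
  decode zero _ = s , refl
  decode (suc zero) _ = t , refl
  decode x@(suc (suc _)) x< with x <? f₂ | x <? f₃
  ... | yes x<f₂ | _ = let i , e = within 2 p x (s≤s (s≤s z≤n)) x<f₂ in a i , ≡-sym e
  ... | no x≮f₂ | yes x<f₃ =
    let i , e = within f₂ q x (≮⇒≥ x≮f₂) (≤-trans x<f₃ (≤-reflexive f₃≡)) in b i , ≡-sym e
  ... | no _ | no x≮f₃ =
    let i , e = within f₃ r x (≮⇒≥ x≮f₃) (≤-trans x< (≤-reflexive (+-suc (p + suc q) r))) in c i , ≡-sym e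

realisation⇒iGraph : ∀ {p q r} → Realisation (V p q r) θ →
  IsIGraph (thetaN (suc p) (suc q) (suc r)) (thetaAdj (suc p) (suc q) (suc r))
realisation⇒iGraph {p} {q} {r} R = ToIGraph.isIGraph (restrict R vertex vertex-injective vertex-adj) first
  where
  order = thetaN (suc p) (suc q) (suc r)
  vertex : Fin order → V p q r
  vertex x = proj₁ (decode (toℕ x) (toℕ<n x))
  code-vertex : ∀ x → code (vertex x) ≡ toℕ x
  code-vertex x = proj₂ (decode (toℕ x) (toℕ<n x))
  vertex-injective : ∀ {x y} → vertex x ≡ vertex y → x ≡ y
  vertex-injective {x} {y} e =
    toℕ-injective (trans (≡-sym (code-vertex x)) (trans (cong code e) (code-vertex y)))
  vertex-adj : ∀ x y → θ (vertex x) (vertex y) ≡ thetaAdj (suc p) (suc q) (suc r) x y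
  vertex-adj x y = ≡-sym (trans (any-∨ (fwd (toℕ x) (toℕ y)) (fwd (toℕ y) (toℕ x)) (thetaEdges (suc p) (suc q) (suc r)))
    (cong₂ _∨_ (dir x y) (dir y x)))
    where
    dir : ∀ x y → any (fwd (toℕ x) (toℕ y)) (thetaEdges (suc p) (suc q) (suc r)) ≡ directed (vertex x) (vertex y)
    dir x y = trans (cong₂ (λ m n → any (fwd m n) (thetaEdges (suc p) (suc q) (suc r)))
                      (≡-sym (code-vertex x)) (≡-sym (code-vertex y)))
                    (directed-code (vertex x) (vertex y))
  first : Fin order
  first = fromℕ< {0} (≤-trans (s≤s z≤n) (m≤n+m (suc r) (p + suc q)))

-- Permuting and lengthening the paths

rotation : ∀ {p q r} → V q r p → V p q r
rotation s = s
rotation t = t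
rotation (a i) = b i
rotation (b i) = c i
rotation (c i) = a i

rotation-injective : ∀ {p q r} {u v : V q r p} → rotation u ≡ rotation v → u ≡ v
rotation-injective {u = u} {v} e =
  trans (≡-sym (back u)) (trans (cong (rotation ∘ rotation) e) (back v))
  where
  back : ∀ {p q r} (u : V q r p) → rotation (rotation (rotation u)) ≡ u
  back s = refl
  back t = refl
  back (a i) = refl
  back (b i) = refl
  back (c i) = refl

rotation-θ : ∀ {p q r} (u v : V q r p) → θ (rotation u) (rotation v) ≡ θ u v
rotation-θ {p} {q} {r} u v = cong₂ _∨_ (dir u v) (dir v u)
  where
  rot₁ : ∀ u → π₁ {p} {q} {r} (rotation u) ≡ π₃ u
  rot₁ s = refl
  rot₁ t = refl
  rot₁ (a i) = refl
  rot₁ (b i) = refl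
  rot₁ (c i) = refl
  rot₂ : ∀ u → π₂ {p} {q} {r} (rotation u) ≡ π₁ u
  rot₂ s = refl
  rot₂ t = refl
  rot₂ (a i) = refl
  rot₂ (b i) = refl
  rot₂ (c i) = refl
  rot₃ : ∀ u → π₃ {p} {q} {r} (rotation u) ≡ π₂ u
  rot₃ s = refl
  rot₃ t = refl
  rot₃ (a i) = refl
  rot₃ (b i) = refl
  rot₃ (c i) = refl
  dir : ∀ u v → directed (rotation u) (rotation v) ≡ directed u v
  dir u v rewrite rot₁ u | rot₁ v | rot₂ u | rot₂ v | rot₃ u | rot₃ v =
    trans (∨-comm (step (π₃ u) (π₃ v)) _) (∨-assoc (step (π₁ u) (π₁ v)) _ _)

next : ∀ {p} {X : Set} → X → (Fin (suc p) → X) → X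
next {zero}  end path = end
next {suc p} end path = path (suc zero)

-- Subdivision replaces the set of a vertex of degree 2, and a path without internal vertices has
-- none; hence the value `⊥`.
MarkedA MarkedB MarkedC : ∀ {p q r} → Realisation (V p q r) θ → Set
MarkedA {p = zero}  R = ⊥
MarkedA {p = suc _} R = Marked R s (a zero) (next t a)
MarkedB {q = zero}  R = ⊥
MarkedB {q = suc _} R = Marked R s (b zero) (next t b)
MarkedC {r = zero}  R = ⊥
MarkedC {r = suc _} R = Marked R s (c zero) (next t c)

-- The Boolean flags record which of the three paths can be lengthened.
record ThetaFamily (p q r : ℕ) (α β γ : Bool) : Set where
  field
    family : Realisation (V p q r) θ
    markA  : T α → MarkedA family
    markB  : T β → MarkedB family
    markC  : T γ → MarkedC family
open ThetaFamily

rotated : ∀ {p q r} → Realisation (V p q r) θ → Realisation (V q r p) θ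
rotated R = restrict R rotation rotation-injective rotation-θ

rotated-marked : ∀ {p q r} (R : Realisation (V p q r) θ) x y z →
                 Marked R (rotation x) (rotation y) (rotation z) → Marked (rotated R) x y z
rotated-marked R = restrict-marked R rotation rotation-injective rotation-θ

rotated-A : ∀ {p q r} (R : Realisation (V p q r) θ) → MarkedB R → MarkedA (rotated R)
rotated-A {q = suc zero}    R = rotated-marked R s (a zero) t
rotated-A {q = suc (suc _)} R = rotated-marked R s (a zero) (a (suc zero))

rotated-B : ∀ {p q r} (R : Realisation (V p q r) θ) → MarkedC R → MarkedB (rotated R)
rotated-B {r = suc zero}    R = rotated-marked R s (b zero) t
rotated-B {r = suc (suc _)} R = rotated-marked R s (b zero) (b (suc zero))

rotated-C : ∀ {p q r} (R : Realisation (V p q r) θ) → MarkedA R → MarkedC (rotated R)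
rotated-C {p = suc zero}    R = rotated-marked R s (c zero) t
rotated-C {p = suc (suc _)} R = rotated-marked R s (c zero) (c (suc zero))

-- Lengthening is proved for the first path only and carried to the others by conjugating with
-- rotations.
rotate : ∀ {p q r α β γ} → ThetaFamily p q r α β γ → ThetaFamily q r p β γ α
rotate F = record
  { family = rotated (family F)
  ; markA = rotated-A (family F) ∘ markB F
  ; markB = rotated-B (family F) ∘ markC F
  ; markC = rotated-C (family F) ∘ markA F
  }

-- The new vertex sits next to `s`, so it becomes the first internal vertex, exactly where `MarkedA`
-- expects the new mark.
collapse : ∀ {p q r} → V (suc p) q r → Maybe (V p q r)
collapse s = just s
collapse t = just t
collapse (a zero) = nothing
collapse (a (suc i)) = just (a i)
collapse (b i) = just (b i)
collapse (c i) = just (c i)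

collapse-injective : ∀ {p q r} {u v : V (suc p) q r} → collapse u ≡ collapse v → u ≡ v
collapse-injective {u = u} {v} e = trans (≡-sym (back u)) (trans (cong expand e) (back v))
  where
  expand : ∀ {p q r} → Maybe (V p q r) → V (suc p) q r
  expand nothing = a zero
  expand (just s) = s
  expand (just t) = t
  expand (just (a i)) = a (suc i)
  expand (just (b i)) = b i
  expand (just (c i)) = c i
  back : ∀ {p q r} (u : V (suc p) q r) → expand (collapse u) ≡ u
  back s = refl
  back t = refl
  back (a zero) = refl
  back (a (suc i)) = refl
  back (b i) = refl
  back (c i) = refl

collapse-θ : ∀ {p q r} (u v : V (suc (suc p)) q r) →
             Subdivided _≟_ θ s (a zero) (collapse u) (collapse v) ≡ θ u v
collapse-θ s s = refl
collapse-θ s t = refl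
collapse-θ s (a zero) = refl
collapse-θ s (a (suc zero)) = refl
collapse-θ s (a (suc (suc i))) = refl
collapse-θ s (b i) = refl
collapse-θ s (c i) = refl
collapse-θ t s = refl
collapse-θ t t = refl
collapse-θ t (a zero) = refl
collapse-θ t (a (suc i)) = refl
collapse-θ t (b i) = refl
collapse-θ t (c i) = refl
collapse-θ (a zero) s = refl
collapse-θ (a zero) t = refl
collapse-θ (a zero) (a zero) = refl
collapse-θ (a zero) (a (suc zero)) = refl
collapse-θ (a zero) (a (suc (suc i))) = refl
collapse-θ (a zero) (b i) = refl
collapse-θ (a zero) (c i) = refl
collapse-θ (a (suc zero)) s = refl
collapse-θ (a (suc (suc i))) s = refl
collapse-θ (a (suc zero)) t = refl
collapse-θ (a (suc (suc i))) t = refl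
collapse-θ (a (suc zero)) (a zero) = refl
collapse-θ (a (suc (suc i))) (a zero) = refl
collapse-θ (a (suc zero)) (a (suc j)) = refl
collapse-θ (a (suc (suc i))) (a (suc j)) = refl
collapse-θ (a (suc zero)) (b j) = refl
collapse-θ (a (suc (suc i))) (b j) = refl
collapse-θ (a (suc zero)) (c j) = refl
collapse-θ (a (suc (suc i))) (c j) = refl
collapse-θ (b i) s = refl
collapse-θ (b i) t = refl
collapse-θ (b i) (a zero) = refl
collapse-θ (b i) (a (suc j)) = refl
collapse-θ (b i) (b j) = refl
collapse-θ (b i) (c j) = refl
collapse-θ (c i) s = refl
collapse-θ (c i) t = refl
collapse-θ (c i) (a zero) = refl
collapse-θ (c i) (a (suc j)) = refl
collapse-θ (c i) (b j) = refl
collapse-θ (c i) (c j) = refl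

first-degree-2 : ∀ {p q r} (w : V (suc p) q r) → w ≢ s → w ≢ next t a → θ (a zero) w ≡ false
first-degree-2 s w≢s _ = ⊥-elim (w≢s refl)
first-degree-2 {zero} t _ w≢t = ⊥-elim (w≢t refl)
first-degree-2 {suc p} t _ _ = refl
first-degree-2 (a zero) _ _ = refl
first-degree-2 {suc p} (a (suc zero)) _ w≢ = ⊥-elim (w≢ refl)
first-degree-2 {suc p} (a (suc (suc i))) _ _ = refl
first-degree-2 (b _) _ _ = refl
first-degree-2 (c _) _ _ = refl

first-next : ∀ {p q r} → θ {suc p} {q} {r} (a zero) (next t a) ≡ true
first-next {zero} = refl
first-next {suc p} = refl

module Lengthen {p q r : ℕ} (R : Realisation (V (suc p) q r) θ) (mark : MarkedA R) where
  open Subdivide _≟_ R θ-sym refl (first-next {p}) first-degree-2 mark public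

  lengthened : Realisation (V (suc (suc p)) q r) θ
  lengthened = restrict subdivide collapse collapse-injective collapse-θ

  pull : ∀ x y z → Marked subdivide (collapse x) (collapse y) (collapse z) → Marked lengthened x y z
  pull = restrict-marked subdivide collapse collapse-injective collapse-θ

  lengthened-A : MarkedA lengthened
  lengthened-A = pull s (a zero) (a (suc zero)) subdivide-marked

lengthened-B : ∀ {p q r} (R : Realisation (V (suc p) q r) θ) (mark : MarkedA R) →
               MarkedB R → MarkedB (Lengthen.lengthened R mark)
lengthened-B {q = suc zero} R mark = pull s (b zero) t ∘ keep-marked (λ ()) (λ ()) (λ ())
  where open Lengthen R mark
lengthened-B {q = suc (suc _)} R mark = pull s (b zero) (b (suc zero)) ∘ keep-marked (λ ()) (λ ()) (λ ())
  where open Lengthen R mark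

lengthened-C : ∀ {p q r} (R : Realisation (V (suc p) q r) θ) (mark : MarkedA R) →
               MarkedC R → MarkedC (Lengthen.lengthened R mark)
lengthened-C {r = suc zero} R mark = pull s (c zero) t ∘ keep-marked (λ ()) (λ ()) (λ ())
  where open Lengthen R mark
lengthened-C {r = suc (suc _)} R mark = pull s (c zero) (c (suc zero)) ∘ keep-marked (λ ()) (λ ()) (λ ())
  where open Lengthen R mark

lengthen : ∀ {p q r β γ} → ThetaFamily (suc p) q r true β γ → ThetaFamily (suc (suc p)) q r true β γ
lengthen F = record
  { family = Lengthen.lengthened (family F) (markA F _)
  ; markA = λ _ → Lengthen.lengthened-A (family F) (markA F _)
  ; markB = lengthened-B (family F) (markA F _) ∘ markB F
  ; markC = lengthened-C (family F) (markA F _) ∘ markC F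
  }

-- The five base families

allV? : ∀ {p q r} {P : V p q r → Set} → (∀ v → Dec (P v)) → Dec (∀ v → P v)
allV? {P = P} P? = map′ to from (P? s ×-dec P? t ×-dec all? (P? ∘ a) ×-dec all? (P? ∘ b) ×-dec all? (P? ∘ c))
  where
  to : P s × P t × (∀ i → P (a i)) × (∀ i → P (b i)) × (∀ i → P (c i)) → ∀ v → P v
  to (ps , _) s = ps
  to (_ , pt , _) t = pt
  to (_ , _ , pa , _) (a i) = pa i
  to (_ , _ , _ , pb , _) (b i) = pb i
  to (_ , _ , _ , _ , pc) (c i) = pc i
  from : (∀ v → P v) → P s × P t × (∀ i → P (a i)) × (∀ i → P (b i)) × (∀ i → P (c i))
  from h = h s , h t , h ∘ a , h ∘ b , h ∘ c

slide? : ∀ {N} (f g : Fin N → Bool) → Dec (Slide f g)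
slide? f g = map′
  (λ { (u , v , p , q , r , e , h) → slide u v p q r e h })
  (λ { (slide u v p q r e h) → u , v , p , q , r , e , h })
  (any? λ u → any? λ v →
    (f u ≟ᵇ true) ×-dec (g u ≟ᵇ false) ×-dec (f v ≟ᵇ false) ×-dec (g v ≟ᵇ true) ×-dec
    all? λ w → ¬? (w ≟ᶠ u) →-dec (¬? (w ≟ᶠ v) →-dec (f w ≟ᵇ g w)))

twoMissing? : ∀ {N} (f g : Fin N → Bool) → Dec (TwoMissing f g)
twoMissing? f g = any? λ u → any? λ v →
  ¬? (u ≟ᶠ v) ×-dec ((f u ≟ᵇ true) ×-dec (g u ≟ᵇ false)) ×-dec ((f v ≟ᵇ true) ×-dec (g v ≟ᵇ false))

module _ {p q r N : ℕ} (φ : V p q r → Fin N → Bool) where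
  Realises : Set
  Realises =
    (∀ x → ∃[ u ] φ x u ≡ true) ×
    (∀ x y → size (φ x) ≡ size (φ y)) ×
    (∀ x y → θ x y ≡ true → Slide (φ x) (φ y)) ×
    (∀ x y → θ x y ≡ false → x ≢ y → TwoMissing (φ x) (φ y)) ×
    (∀ x v → φ x v ≡ false → ∃[ u ] φ x u ≡ true × (∀ w → φ w u ≡ true → φ w v ≡ false))

  realises? : Dec Realises
  realises? =
    (allV? λ x → any? λ u → φ x u ≟ᵇ true) ×-dec
    (allV? λ x → allV? λ y → size (φ x) ≟ⁿ size (φ y)) ×-dec
    (allV? λ x → allV? λ y → (θ x y ≟ᵇ true) →-dec slide? (φ x) (φ y)) ×-dec
    (allV? λ x → allV? λ y → (θ x y ≟ᵇ false) →-dec (¬? (x ≟ y) →-dec twoMissing? (φ x) (φ y))) ×-dec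
    (allV? λ x → all? λ v → (φ x v ≟ᵇ false) →-dec
      any? λ u → (φ x u ≟ᵇ true) ×-dec allV? λ w → (φ w u ≟ᵇ true) →-dec (φ w v ≟ᵇ false))

  realisation : Realises → Realisation (V p q r) θ
  realisation (ne , sz , ad , di , mx) = record
    { φ = φ ; nonempty = ne ; same-size = sz ; adjacent = ad ; distant = di ; maximal = mx }

module _ {p q r : ℕ} (R : Realisation (V p q r) θ) where
  open Realisation R

  marked? : ∀ x y z → Dec (Marked R x y z)
  marked? x y z = any? λ b → any? λ d →
    ((φ x b ≟ᵇ true) ×-dec (φ y b ≟ᵇ true) ×-dec (φ z b ≟ᵇ false)) ×-dec
    ((φ x d ≟ᵇ false) ×-dec (φ y d ≟ᵇ true) ×-dec (φ z d ≟ᵇ true)) ×-dec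
    allV? λ w → (φ w b ≟ᵇ true) →-dec ((φ w d ≟ᵇ true) →-dec (w ≟ y))

markedA? : ∀ {p q r} (R : Realisation (V p q r) θ) → Dec (MarkedA R)
markedA? {p = zero}  R = no id
markedA? {p = suc _} R = marked? R s (a zero) (next t a)

markedB? : ∀ {p q r} (R : Realisation (V p q r) θ) → Dec (MarkedB R)
markedB? {q = zero}  R = no id
markedB? {q = suc _} R = marked? R s (b zero) (next t b)

markedC? : ∀ {p q r} (R : Realisation (V p q r) θ) → Dec (MarkedC R)
markedC? {r = zero}  R = no id
markedC? {r = suc _} R = marked? R s (c zero) (next t c)

-- The token sets of s and t and of the internal vertices of the three paths,
-- in the order from s to t.
data Rows (p q r N : ℕ) : Set where
  rows : Vec Bool N → Vec Bool N → Vec (Vec Bool N) p → Vec (Vec Bool N) q → Vec (Vec Bool N) r → Rows p q r N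

tokens : ∀ {p q r N} → Rows p q r N → V p q r → Fin N → Bool
tokens (rows σ _ _ _ _) s = lookup σ
tokens (rows _ τ _ _ _) t = lookup τ
tokens (rows _ _ as _ _) (a i) = lookup (lookup as i)
tokens (rows _ _ _ bs _) (b i) = lookup (lookup bs i)
tokens (rows _ _ _ _ cs) (c i) = lookup (lookup cs i)

-- For concrete rows both `True` arguments evaluate to the unit type and are filled in
-- automatically.
byRows : ∀ {p q r N} (ρ : Rows p q r N) (α β γ : Bool) (ok : True (realises? (tokens ρ))) →
         let R = realisation (tokens ρ) (toWitness ok) in
         True ((T? α →-dec markedA? R) ×-dec (T? β →-dec markedB? R) ×-dec (T? γ →-dec markedC? R)) →
         ThetaFamily p q r α β γ
byRows ρ α β γ ok marks = let mA , mB , mC = toWitness marks in record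
  { family = realisation (tokens ρ) (toWitness ok) ; markA = mA ; markB = mB ; markC = mC }

private
  I O : Bool
  I = true
  O = false

-- Tokens 0, 1, 2 (counted from 0) go round the triangle of `s`, `t` and `b zero` beside token 3;
-- replacing 3 by 4 copies the edge `s t` and closes a square.
rows123 : Rows 0 1 2 5
rows123 = rows
  (I ∷ O ∷ O ∷ I ∷ O ∷ [])
  (O ∷ I ∷ O ∷ I ∷ O ∷ [])
  ([])
  ((O ∷ O ∷ I ∷ I ∷ O ∷ []) ∷
   [])
  ((I ∷ O ∷ O ∷ O ∷ I ∷ []) ∷
   (O ∷ I ∷ O ∷ O ∷ I ∷ []) ∷
   [])

-- The token pairs 0/1, 2/3, 4/5 are the coordinates of a cube; its two squares through the edge
-- `s t` remain.
rows133 : Rows 0 2 2 6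
rows133 = rows
  (I ∷ O ∷ I ∷ O ∷ I ∷ O ∷ [])
  (O ∷ I ∷ I ∷ O ∷ I ∷ O ∷ [])
  ([])
  ((I ∷ O ∷ O ∷ I ∷ I ∷ O ∷ []) ∷
   (O ∷ I ∷ O ∷ I ∷ I ∷ O ∷ []) ∷
   [])
  ((I ∷ O ∷ I ∷ O ∷ O ∷ I ∷ []) ∷
   (O ∷ I ∷ I ∷ O ∷ O ∷ I ∷ []) ∷
   [])

rows225 : Rows 1 1 4 7
rows225 = rows
  (I ∷ O ∷ I ∷ O ∷ I ∷ O ∷ O ∷ [])
  (O ∷ I ∷ O ∷ I ∷ I ∷ O ∷ O ∷ [])
  ((O ∷ I ∷ I ∷ O ∷ I ∷ O ∷ O ∷ []) ∷
   [])
  ((I ∷ O ∷ O ∷ I ∷ I ∷ O ∷ O ∷ []) ∷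
   [])
  ((I ∷ O ∷ I ∷ O ∷ O ∷ I ∷ O ∷ []) ∷
   (O ∷ O ∷ I ∷ O ∷ O ∷ I ∷ I ∷ []) ∷
   (O ∷ O ∷ O ∷ I ∷ O ∷ I ∷ I ∷ []) ∷
   (O ∷ I ∷ O ∷ I ∷ O ∷ O ∷ I ∷ []) ∷
   [])

rows244 : Rows 1 3 3 8
rows244 = rows
  (I ∷ O ∷ I ∷ O ∷ O ∷ O ∷ I ∷ O ∷ [])
  (O ∷ I ∷ O ∷ I ∷ O ∷ O ∷ I ∷ O ∷ [])
  ((O ∷ I ∷ I ∷ O ∷ O ∷ O ∷ I ∷ O ∷ []) ∷
   [])
  ((I ∷ O ∷ O ∷ O ∷ I ∷ O ∷ I ∷ O ∷ []) ∷
   (O ∷ O ∷ O ∷ O ∷ I ∷ I ∷ I ∷ O ∷ []) ∷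
   (O ∷ O ∷ O ∷ I ∷ O ∷ I ∷ I ∷ O ∷ []) ∷
   [])
  ((I ∷ O ∷ I ∷ O ∷ O ∷ O ∷ O ∷ I ∷ []) ∷
   (I ∷ O ∷ O ∷ I ∷ O ∷ O ∷ O ∷ I ∷ []) ∷
   (O ∷ I ∷ O ∷ I ∷ O ∷ O ∷ O ∷ I ∷ []) ∷
   [])

rows334 : Rows 2 2 3 8
rows334 = rows
  (I ∷ O ∷ I ∷ O ∷ O ∷ O ∷ I ∷ O ∷ [])
  (O ∷ O ∷ O ∷ I ∷ I ∷ O ∷ I ∷ O ∷ [])
  ((O ∷ I ∷ I ∷ O ∷ O ∷ O ∷ I ∷ O ∷ []) ∷
   (O ∷ I ∷ O ∷ I ∷ O ∷ O ∷ I ∷ O ∷ []) ∷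
   [])
  ((I ∷ O ∷ O ∷ O ∷ O ∷ I ∷ I ∷ O ∷ []) ∷
   (O ∷ O ∷ O ∷ O ∷ I ∷ I ∷ I ∷ O ∷ []) ∷
   [])
  ((I ∷ O ∷ I ∷ O ∷ O ∷ O ∷ O ∷ I ∷ []) ∷
   (O ∷ O ∷ I ∷ O ∷ I ∷ O ∷ O ∷ I ∷ []) ∷
   (O ∷ O ∷ O ∷ I ∷ I ∷ O ∷ O ∷ I ∷ []) ∷
   [])

family123 : ThetaFamily 0 1 2 false false true
family123 = byRows rows123 _ _ _ _ _

family133 : ThetaFamily 0 2 2 false true true
family133 = byRows rows133 _ _ _ _ _

family225 : ThetaFamily 1 1 4 true true true
family225 = byRows rows225 _ _ _ _ _

family244 : ThetaFamily 1 3 3 true true true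
family244 = byRows rows244 _ _ _ _ _

family334 : ThetaFamily 2 2 3 false false false
family334 = byRows rows334 _ _ _ _ _

lengthenA : ∀ {p p′ q r β γ} → p ≤ p′ → ThetaFamily (suc p) q r true β γ → ThetaFamily (suc p′) q r true β γ
lengthenA p≤p′ F = go (≤⇒≤′ p≤p′)
  where
  go : ∀ {p′} → _ ≤′ p′ → ThetaFamily (suc p′) _ _ true _ _
  go ≤′-refl = F
  go (≤′-step h) = lengthen (go h)

lengthenB : ∀ {p q q′ r α γ} → q ≤ q′ → ThetaFamily p (suc q) r α true γ → ThetaFamily p (suc q′) r α true γ
lengthenB q≤q′ = rotate ∘ rotate ∘ lengthenA q≤q′ ∘ rotate

lengthenC : ∀ {p q r r′ α β} → r ≤ r′ → ThetaFamily p q (suc r) α β true → ThetaFamily p q (suc r′) α β true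
lengthenC r≤r′ = rotate ∘ lengthenA r≤r′ ∘ rotate ∘ rotate

IsTheta : ℕ → ℕ → ℕ → Set
IsTheta j k ℓ = IsIGraph (thetaN j k ℓ) (thetaAdj j k ℓ)

iGraph : ∀ {p q r α β γ} → ThetaFamily p q r α β γ → IsTheta (suc p) (suc q) (suc r)
iGraph = realisation⇒iGraph ∘ ThetaFamily.family

exception⇒not : ∀ {j k ℓ} → (j , k , ℓ) ∈ exceptions → ¬ IsTheta j k ℓ
exception⇒not (here refl) = not-iGraph refl
exception⇒not (there (here refl)) = not-iGraph refl
exception⇒not (there (there (here refl))) = not-iGraph refl
exception⇒not (there (there (there (here refl)))) = not-iGraph refl
exception⇒not (there (there (there (there (here refl))))) = not-iGraph refl
exception⇒not (there (there (there (there (there (here refl)))))) = not-iGraph refl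
exception⇒not (there (there (there (there (there (there (here refl))))))) = not-iGraph refl

_∉exceptions : ℕ × ℕ × ℕ → Set
x ∉exceptions = ¬ x ∈ exceptions

excluded : ∀ {X : Set} {x} → {x∈ : True (x ∈? exceptions)} → x ∉exceptions → X
excluded {x∈ = x∈} x∉ = ⊥-elim (x∉ (toWitness x∈))

realisable-≤4 : ∀ {j k ℓ} → j ≤ k → k ≤ ℓ → ℓ ≤ 2 → (2 + j , 2 + k , 2 + ℓ) ∉exceptions →
                IsTheta (2 + j) (2 + k) (2 + ℓ)
realisable-≤4 z≤n z≤n z≤n = excluded
realisable-≤4 z≤n z≤n (s≤s z≤n) = excluded
realisable-≤4 z≤n (s≤s z≤n) (s≤s z≤n) = excluded
realisable-≤4 (s≤s z≤n) (s≤s z≤n) (s≤s z≤n) = excluded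
realisable-≤4 z≤n z≤n (s≤s (s≤s z≤n)) = excluded
realisable-≤4 z≤n (s≤s z≤n) (s≤s (s≤s z≤n)) = excluded
realisable-≤4 (s≤s z≤n) (s≤s z≤n) (s≤s (s≤s z≤n)) _ = iGraph family334
realisable-≤4 j≤2 (s≤s (s≤s z≤n)) (s≤s (s≤s z≤n)) _ = iGraph (lengthenA z≤n family244)

realisable : ∀ j k ℓ → 1 ≤ j → j ≤ k → k ≤ ℓ → 2 ≤ k → (j , k , ℓ) ∉exceptions → IsTheta j k ℓ
realisable 1 1 _ _ _ _ (s≤s ())
realisable 1 2 1 _ _ (s≤s ()) _
realisable 1 2 2 _ _ _ _ = excluded
realisable 1 2 (suc (suc (suc ℓ))) _ _ _ _ _ = iGraph (lengthenC (s≤s z≤n) family123)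
realisable 1 (suc (suc (suc k))) (suc (suc (suc ℓ))) _ _ _ _ _ =
  iGraph (lengthenC (s≤s z≤n) (lengthenB (s≤s z≤n) family133))
realisable 1 (suc (suc (suc k))) 1 _ _ (s≤s ()) _
realisable 1 (suc (suc (suc k))) 2 _ _ (s≤s (s≤s ())) _
realisable (suc (suc j)) (suc (suc k)) (suc (suc ℓ)) _ (s≤s (s≤s j≤k)) (s≤s (s≤s k≤ℓ)) _ with ≤-<-connex ℓ 2
... | inj₁ ℓ≤2 = realisable-≤4 j≤k k≤ℓ ℓ≤2
... | inj₂ 3≤ℓ = λ _ → iGraph (lengthenC 3≤ℓ (lengthenB z≤n (lengthenA z≤n family225)))
realisable (suc (suc j)) (suc (suc k)) 1 _ _ (s≤s ()) _
realisable (suc (suc j)) 1 _ _ (s≤s ()) _ _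

mainTheorem1 : (j k ℓ : ℕ) → 1 ≤ j → j ≤ k → k ≤ ℓ → 2 ≤ k →
    IsIGraph (thetaN j k ℓ) (thetaAdj j k ℓ) ⇔ (¬ ((j , k , ℓ) ∈ exceptions))
mainTheorem1 j k ℓ 1≤j j≤k k≤ℓ 2≤k =
  mk⇔ (λ isI e → exception⇒not e isI) (realisable j k ℓ 1≤j j≤k k≤ℓ 2≤k)
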